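{- Let $q$ be an odd prime power, fix $\epsilon\in\mathbb{F}_{q^2}\setminus\mathbb{F}_q$ with $\epsilon^q=-\epsilon$ and put $\delta=\epsilon^2\in\mathbb{F}_q$. Let $a=a_0+\epsilon a_1\in\mathbb{F}_{q^2}^*$, $b=b_0+\epsilon b_1\in\mathbb{F}_{q^2}\setminus\mathbb{F}_q$ ($a_i,b_i\in\mathbb{F}_q$) with $4a^{q+1}+(b^q-b)^2\neq 0$, and let $\mathcal{M}_{a,b}$ be the BM quasi-Hermitian variety of $\mathrm{PG}(3,q^2)$, i.e. \[ \mathcal{M}_{a,b}=\{(1,x,y,z): z+a(x^2+y^2)-b(x^{q+1}+y^{q+1})\in\mathbb{F}_q\}\ \cup\ \{(0,X,Y,Z): X^{q+1}+Y^{q+1}=0\}. \] Then in the Barlotti--Cofman representation in $\mathrm{PG}(6,q)$ the affine points of $\mathcal{M}_{a,b}$ correspond to the affine points of the quadratic cone $\mathcal{B}'$ with equation \[ x_0x_6+2a_0(x_1x_2+x_3x_4)+a_1\big(x_1^2+x_3^2+\delta(x_2^2+x_4^2)\big)-b_1\big(x_1^2-\delta x_2^2+x_3^2-\delta x_4^2\big)=0, \] which has vertex $V=(0,0,0,0,0,1,0)$ and whose base is a hyperbolic quadric. The points at infinity of $\mathcal{M}_{a,b}$ correspond to $q^3+q^2+1$ spread lines, which partition the set $\{x_0=0,\ x_1^2-\delta x_2^2+x_3^2-\delta x_4^2=0\}$. Among these lines, $2q^2+1$ are contained in $\mathcal{B}'$ if $q\equiv 1\pmod 4$, whereas exactly one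 is contained in $\mathcal{B}'$ if $q\equiv 3\pmod 4$.
   Context: Points of $\mathrm{PG}(3,q^2)$ have homogeneous coordinates $(J,X,Y,Z)$, with plane at infinity $J=0$ and affine points written $(1,x,y,z)$; points of $\mathrm{PG}(6,q)$ have homogeneous coordinates $(x_0,\dots,x_6)$, with hyperplane at infinity $x_0=0$. Every $c\in\mathbb{F}_{q^2}$ is written uniquely as $c=c_0+\epsilon c_1$, $c_0,c_1\in\mathbb{F}_q$. Barlotti--Cofman representation: the affine point $(1,x,y,z)$ with $x=x_1+\epsilon x_2$, $y=x_3+\epsilon x_4$, $z=x_5+\epsilon x_6$ corresponds to $(1,x_1,\dots,x_6)$; a point $P=(0,u,v,w)$ at infinity corresponds to the spread line $r_P$ of $\{x_0=0\}$ consisting of the points $(0,u'_0,u'_1,v'_0,v'_1,w'_0,w'_1)$ with $(u',v',w')=(\lambda u,\lambda v,\lambda w)$, $\lambda\in\mathbb{F}_{q^2}^*$. The lines $r_P$ form a Desarguesian line spread of $\{x_0=0\}$. The base of the cone $\mathcal{B}'$ is the quadric of $\mathrm{PG}(5,q)$ in coordinates $x_0,x_1,x_2,x_3,x_4,x_6$ given by the same equation. -}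

module Defs where

open import Level using (0ℓ)
open import Data.Nat as ℕ using (ℕ; zero; suc)
open import Data.Product using (Σ; ∃; _×_; _,_; proj₁; proj₂)
open import Data.Sum using (_⊎_)
open import Data.Unit using (⊤)
open import Data.Vec using (Vec; []; _∷_; map; zipWith; replicate)
open import Data.List using (List; length)
open import Data.List.Membership.Propositional using (_∈_)
open import Data.List.Relation.Unary.Unique.Propositional using (Unique)
open import Relation.Binary.PropositionalEquality using (_≡_; _≢_)
open import Relation.Binary.Definitions using (DecidableEquality)
open import Relation.Nullary using (¬_)
open import Function.Bundles using (_⇔_)
open import Algebra.Core using (Op₁; Op₂)
open import Algebra.Structures using (IsCommutativeRing)

HasCard : (A : Set) → (A → Set) → ℕ → Set
HasCard A P n =
  Σ (List A) λ xs → Unique xs × (∀ x → (x ∈ xs) ⇔ P x) × length xs ≡ n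

record FiniteField (q : ℕ) : Set₁ where
  infixl 6 _+_
  infixl 7 _*_
  infix  8 -_
  field
    Carrier           : Set
    _+_ _*_           : Op₂ Carrier
    -_                : Op₁ Carrier
    0# 1#             : Carrier
    isCommutativeRing : IsCommutativeRing _≡_ _+_ _*_ -_ 0# 1#
    0≢1               : 0# ≢ 1#
    inverse           : ∀ x → x ≢ 0# → ∃ λ y → x * y ≡ 1#
    _≟_               : DecidableEquality Carrier
    card              : HasCard Carrier (λ _ → ⊤) q

-- Canonical representatives of projective points: nonzero vectors whose
-- first nonzero coordinate is 1.  Points of PG(n,F) = normalized vectors
-- of length n+1.

data Normalized {A : Set} (z o : A) : ∀ {n} → Vec A n → Set where
  here  : ∀ {n} (xs : Vec A n) → Normalized z o (o ∷ xs)
  there : ∀ {n} {xs : Vec A n} → Normalized z o xs → Normalized z o (z ∷ xs)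

-- The setting: F_q = Carrier K, and F_{q^2} = F_q[ε]/(ε² - δ), whose
-- elements c = c₀ + ε c₁ are written as pairs (c₀ , c₁).

module Setting {q : ℕ} (K : FiniteField q) (δ : FiniteField.Carrier K) where

  open FiniteField K public

  _-_ : Op₂ Carrier
  x - y = x + (- y)
  infixl 6 _-_

  sq : Carrier → Carrier
  sq x = x * x

  two : Carrier
  two = 1# + 1#

  F2 : Set
  F2 = Carrier × Carrier

  0₂ 1₂ ε : F2
  0₂ = 0# , 0#
  1₂ = 1# , 0#
  ε  = 0# , 1#

  _+₂_ _*₂_ _-₂_ : Op₂ F2
  (x₀ , x₁) +₂ (y₀ , y₁) = (x₀ + y₀) , (x₁ + y₁)
  (x₀ , x₁) *₂ (y₀ , y₁) = (x₀ * y₀ + δ * (x₁ * y₁)) , (x₀ * y₁ + x₁ * y₀)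
  neg₂ : Op₁ F2
  neg₂ (x₀ , x₁) = (- x₀) , (- x₁)
  x -₂ y = x +₂ neg₂ y
  infixl 6 _+₂_ _-₂_
  infixl 7 _*₂_

  _^₂_ : F2 → ℕ → F2
  x ^₂ zero  = 1₂
  x ^₂ suc n = x *₂ (x ^₂ n)
  infixr 9 _^₂_

  four₂ : F2
  four₂ = 1₂ +₂ 1₂ +₂ 1₂ +₂ 1₂

  InFq : F2 → Set
  InFq c = proj₂ c ≡ 0#

  _⊕_ : ∀ {n} → Vec Carrier n → Vec Carrier n → Vec Carrier n
  _⊕_ = zipWith _+_
  _⊙_ : ∀ {n} → Carrier → Vec Carrier n → Vec Carrier n
  t ⊙ v = map (t *_) v
  infixl 6 _⊕_
  infixl 7 _⊙_
  zeroV : ∀ {n} → Vec Carrier n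
  zeroV = replicate _ 0#

  NormalizedF : ∀ {n} → Vec Carrier n → Set
  NormalizedF = Normalized 0# 1#

  NormalizedF2 : ∀ {n} → Vec F2 n → Set
  NormalizedF2 = Normalized 0₂ 1₂

  polar : ∀ {n} → (Vec Carrier n → Carrier) → Vec Carrier n → Vec Carrier n → Carrier
  polar Q v w = Q (v ⊕ w) - Q v - Q w

  -- nondegenerate quadratic form (q odd): trivial radical of the polar form
  Nondegenerate : ∀ {n} → (Vec Carrier n → Carrier) → Set
  Nondegenerate Q = ∀ v → (∀ w → polar Q v w ≡ 0#) → v ≡ zeroV

  -- hyperbolic quadric of PG(5,q): nondegenerate and containing a plane
  -- (a totally singular subspace of vector dimension 3, i.e. Witt index 3)
  HyperbolicPG5 : (Vec Carrier 6 → Carrier) → Set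
  HyperbolicPG5 Q =
    Nondegenerate Q ×
    Σ (Vec Carrier 6) λ u₁ → Σ (Vec Carrier 6) λ u₂ → Σ (Vec Carrier 6) λ u₃ →
      (∀ l₁ l₂ l₃ → l₁ ⊙ u₁ ⊕ l₂ ⊙ u₂ ⊕ l₃ ⊙ u₃ ≡ zeroV →
         (l₁ ≡ 0#) × (l₂ ≡ 0#) × (l₃ ≡ 0#)) ×
      (∀ l₁ l₂ l₃ → Q (l₁ ⊙ u₁ ⊕ l₂ ⊙ u₂ ⊕ l₃ ⊙ u₃) ≡ 0#)

  bcAff : F2 → F2 → F2 → Vec Carrier 7
  bcAff (x₁ , x₂) (x₃ , x₄) (x₅ , x₆) = 1# ∷ x₁ ∷ x₂ ∷ x₃ ∷ x₄ ∷ x₅ ∷ x₆ ∷ []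

  bcInf : Vec F2 4 → Vec Carrier 7
  bcInf (_ ∷ (u₀ , u₁) ∷ (v₀ , v₁) ∷ (w₀ , w₁) ∷ []) =
    0# ∷ u₀ ∷ u₁ ∷ v₀ ∷ v₁ ∷ w₀ ∷ w₁ ∷ []

  OnSpreadLine : Vec F2 4 → Vec Carrier 7 → Set
  OnSpreadLine P w = Σ F2 λ l → l ≢ 0₂ × w ≡ bcInf (map (l *₂_) P)

  InS : Vec Carrier 7 → Set
  InS (x₀ ∷ x₁ ∷ x₂ ∷ x₃ ∷ x₄ ∷ x₅ ∷ x₆ ∷ []) =
    (x₀ ≡ 0#) × (sq x₁ - δ * sq x₂ + sq x₃ - δ * sq x₄ ≡ 0#)

  V : Vec Carrier 7
  V = 0# ∷ 0# ∷ 0# ∷ 0# ∷ 0# ∷ 1# ∷ 0# ∷ []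

  module BM (a b : F2) where

    a₀ a₁ b₁ : Carrier
    a₀ = proj₁ a
    a₁ = proj₂ a
    b₁ = proj₂ b

    InM : Vec F2 4 → Set
    InM (J ∷ x ∷ y ∷ z ∷ []) =
      (J ≡ 1₂ × InFq (z +₂ a *₂ (x *₂ x +₂ y *₂ y)
                        -₂ b *₂ (x ^₂ (suc q) +₂ y ^₂ (suc q))))
      ⊎ (J ≡ 0₂ × x ^₂ (suc q) +₂ y ^₂ (suc q) ≡ 0₂)

    PtInfM : Vec F2 4 → Set
    PtInfM (J ∷ P) = NormalizedF2 (J ∷ P) × J ≡ 0₂ × InM (J ∷ P)

    QB : Vec Carrier 7 → Carrier
    QB (x₀ ∷ x₁ ∷ x₂ ∷ x₃ ∷ x₄ ∷ x₅ ∷ x₆ ∷ []) =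
      x₀ * x₆ + two * a₀ * (x₁ * x₂ + x₃ * x₄)
      + a₁ * (sq x₁ + sq x₃ + δ * (sq x₂ + sq x₄))
      - b₁ * (sq x₁ - δ * sq x₂ + sq x₃ - δ * sq x₄)

    QBase : Vec Carrier 6 → Carrier
    QBase (x₀ ∷ x₁ ∷ x₂ ∷ x₃ ∷ x₄ ∷ x₆ ∷ []) =
      x₀ * x₆ + two * a₀ * (x₁ * x₂ + x₃ * x₄)
      + a₁ * (sq x₁ + sq x₃ + δ * (sq x₂ + sq x₄))
      - b₁ * (sq x₁ - δ * sq x₂ + sq x₃ - δ * sq x₄)

    LineInB : Vec F2 4 → Set
    LineInB P = ∀ w → OnSpreadLine P w → QB w ≡ 0#

-- Write N(x) = x₀² - δ x₁² for x = x₀ + ε x₁. Since ε^q = -ε, the Frobenius map is x ↦ x₀ - ε x₁, so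
-- x^{q+1} = N(x), and taking ε-components in the affine equation of M gives the form QB.
--
-- QB is x₀x₆ + f(x₁,x₂) + f(x₃,x₄) for one binary form f, and the hypothesis on a and b says exactly that the
-- discriminant d of f is nonzero. Solving s² + d t² = -1 gives a similitude T of f with multiplier -1, and
-- the graph of T together with the x₆-axis is a totally singular plane of the base.
--
-- The points of M at infinity are (0,0,0,1) and (0,1,y,z) with N(y) = -1, and there are q + 1 such y by
-- Hilbert 90. On the spread line of (0,1,y,z), QB at λ is the ε-component of a(1 + y²)λ²; it vanishes for
-- all λ iff y² = -1, which together with N(y) = -1 forces y ∈ F_q. Hence the dependence on q mod 4.

module Submission where

-- The field is given only by its ring laws, inverses and a list of its q elements without
-- repetition, so its characteristic, the law x^q = x and the abundance of squares all come from
-- counting: translations and scalings permute the list, and two subsets with more than q/2 elements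
-- meet. Additivity of x ↦ x^q on F_{q²} needs q to be a power of a prime; it extends the single
-- hypothesis ε^q = -ε to the conjugation formula everywhere.
--
-- The plane in the base needs no case distinction on whether f has a nontrivial zero. With T of
-- multiplier -1, f(v) + f(Tv) = f(v) - f(v) = 0 for every v, so the graph of T is a totally
-- singular 2-space of f(x₁,x₂) + f(x₃,x₄) in either case.
--
-- The number b enters the cone only through b₁(N(x) + N(y)), which vanishes at the infinite points
-- of the variety. This is why containment of a spread line in the cone is decided by a and y alone,
-- and, as a is invertible, by y.
--
-- The coordinate z is free on the points (0,1,y,z), so each admissible y contributes q² lines: q +
-- 1 values of y in all, two of them with y² = -1 or none.

open import Defs
open import Level using (0ℓ)
open import Algebra.Bundles using (CommutativeRing)
import Algebra.Properties.CommutativeSemiring.Exp as CommutativeExp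
import Algebra.Properties.Semiring.Exp as Exp
import Algebra.Properties.Semiring.Mult as Mult
open import Algebra.Solver.Ring.AlmostCommutativeRing
  using (fromCommutativeRing; _-Raw-AlmostCommutative⟶_; Induced-equivalence)
open import Algebra.Structures using (IsCommutativeRing)
open import Data.Empty using (⊥; ⊥-elim)
open import Data.Fin as Fin using (Fin; zero; suc; toℕ; inject₁)
import Data.Fin.Properties as Finₚ
open import Data.Integer as ℤ using (ℤ; 0ℤ; 1ℤ)
import Data.Integer.Properties as ℤₚ
open import Data.List using (List; []; _∷_; length; map; _++_; cartesianProduct; foldr; filter)
import Data.List.Properties as Listₚ
open import Data.List.Membership.Propositional using (_∈_; lose)
open import Data.List.Membership.Propositional.Properties
  using (∈-map⁺; ∈-map⁻; ∈-∃++; ∈-++⁻; ∈-++⁺ˡ; ∈-++⁺ʳ; ∈-filter⁺; ∈-filter⁻; ∈-cartesianProduct⁺; ∈-cartesianProduct⁻)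
open import Data.List.Membership.Propositional.Properties.WithK using (unique∧set⇒bag)
open import Data.List.Relation.Binary.BagAndSetEquality using (∼bag⇒↭)
open import Data.List.Relation.Binary.Permutation.Propositional using (_↭_; ↭⇒↭ₛ)
open import Data.List.Relation.Binary.Permutation.Setoid.Properties using (foldr-commMonoid)
open import Data.List.Relation.Unary.All as All using ([]; _∷_)
open import Data.List.Relation.Unary.AllPairs using ([]; _∷_)
open import Data.List.Relation.Unary.Any as Any using (any?; here; there)
open import Data.List.Relation.Unary.Unique.Propositional using (Unique)
import Data.List.Relation.Unary.Unique.Propositional.Properties as Unique
open import Data.Maybe using (just; nothing)
open import Data.Nat as N using (ℕ; zero; suc; _∸_; _≤_; _<_; s≤s; z≤n; _!; _%_; _/_)
import Data.Nat.Combinatorics as Comb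
open import Data.Nat.Divisibility using (_∣_; divides; ∣⇒≤; m∣m*n)
open import Data.Nat.DivMod using (m/n*n≡m; m≡m%n+[m/n]*n; m*n%n≡0)
open import Data.Nat.Primality using (Prime; euclidsLemma; prime⇒nonTrivial)
import Data.Nat.Properties as ℕₚ
import Data.Nat.Solver as ℕSolver
import Data.Sign as Sign
open import Data.Sum using (_⊎_; inj₁; inj₂)
open import Data.Unit using (⊤; tt)
open import Data.Vec as Vec using (Vec; []; _∷_)
open import Function.Base using (_∘_)
open import Function.Bundles using (_⇔_; mk⇔; Equivalence)
open import Relation.Binary.Definitions using (WeaklyDecidable)
open import Relation.Binary.PropositionalEquality as ≡ using (_≡_; _≢_)
open import Relation.Nullary using (¬_; Dec; yes; no)
open import Relation.Nullary.Decidable using (¬?)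

-- A ring solver with integer coefficients

module IntegerSolver {c ℓ} (R : CommutativeRing c ℓ) where
  open CommutativeRing R
  open import Data.Integer using (+_; -[1+_]; _⊖_)
  open import Algebra.Properties.Ring ring using (-‿distribˡ-*; -‿distribʳ-*; -0#≈0#; -‿involutive)
  open import Algebra.Properties.AbelianGroup +-abelianGroup using (⁻¹-∙-comm)
  open import Algebra.Properties.Semiring.Mult semiring using (_×_; ×-homo-+; ×1-homo-*)
  open import Relation.Binary.Reasoning.Setoid setoid

  -- The separate clause for 1 makes `fromℕ 1` reduce to `1#` rather than `1# + 0#`. Solver
  -- constants `con 1ℤ` then agree with the `1#` of the goals by computation.
  fromℕ : ℕ → Carrier
  fromℕ zero          = 0#
  fromℕ (suc zero)    = 1#
  fromℕ (suc (suc n)) = 1# + fromℕ (suc n)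

  fromℕ≈×1 : ∀ n → fromℕ n ≈ n × 1#
  fromℕ≈×1 zero          = refl
  fromℕ≈×1 (suc zero)    = sym (+-identityʳ 1#)
  fromℕ≈×1 (suc (suc n)) = +-congˡ (fromℕ≈×1 (suc n))

  fromℕ-+ : ∀ m n → fromℕ (m N.+ n) ≈ fromℕ m + fromℕ n
  fromℕ-+ m n = begin
    fromℕ (m N.+ n)     ≈⟨ fromℕ≈×1 (m N.+ n) ⟩
    (m N.+ n) × 1#      ≈⟨ ×-homo-+ 1# m n ⟩
    m × 1# + n × 1#     ≈⟨ +-cong (fromℕ≈×1 m) (fromℕ≈×1 n) ⟨
    fromℕ m + fromℕ n   ∎

  fromℕ-* : ∀ m n → fromℕ (m N.* n) ≈ fromℕ m * fromℕ n
  fromℕ-* m n = begin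
    fromℕ (m N.* n)      ≈⟨ fromℕ≈×1 (m N.* n) ⟩
    (m N.* n) × 1#       ≈⟨ ×1-homo-* m n ⟩
    (m × 1#) * (n × 1#)  ≈⟨ *-cong (fromℕ≈×1 m) (fromℕ≈×1 n) ⟨
    fromℕ m * fromℕ n    ∎

  fromℤ : ℤ → Carrier
  fromℤ (+ n)    = fromℕ n
  fromℤ -[1+ n ] = - fromℕ (suc n)

  fromℤ-neg : ∀ i → fromℤ (ℤ.- i) ≈ - fromℤ i
  fromℤ-neg (+ zero)  = sym -0#≈0#
  fromℤ-neg (+ suc n) = refl
  fromℤ-neg -[1+ n ]  = sym (-‿involutive _)

  fromℤ-⊖ : ∀ m n → fromℤ (m ⊖ n) ≈ fromℕ m - fromℕ n
  fromℤ-⊖ m zero = begin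
    fromℕ m           ≈⟨ +-identityʳ _ ⟨
    fromℕ m + 0#      ≈⟨ +-congˡ -0#≈0# ⟨
    fromℕ m - 0#      ∎
  fromℤ-⊖ zero (suc n) = sym (+-identityˡ _)
  fromℤ-⊖ (suc m) (suc n) = begin
    fromℤ (suc m ⊖ suc n)                     ≡⟨ ≡.cong fromℤ (ℤₚ.[1+m]⊖[1+n]≡m⊖n m n) ⟩
    fromℤ (m ⊖ n)                             ≈⟨ fromℤ-⊖ m n ⟩
    fromℕ m - fromℕ n                         ≈⟨ +-congʳ (+-identityʳ _) ⟨
    fromℕ m + 0# - fromℕ n                    ≈⟨ +-congʳ (+-congˡ (-‿inverseʳ 1#)) ⟨
    fromℕ m + (1# - 1#) - fromℕ n             ≈⟨ +-congʳ (+-assoc _ _ _) ⟨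
    fromℕ m + 1# - 1# - fromℕ n               ≈⟨ +-congʳ (+-congʳ (+-comm _ _)) ⟩
    1# + fromℕ m - 1# - fromℕ n               ≈⟨ +-assoc _ _ _ ⟩
    1# + fromℕ m + (- 1# - fromℕ n)           ≈⟨ +-congˡ (⁻¹-∙-comm _ _) ⟩
    1# + fromℕ m - (1# + fromℕ n)             ≈⟨ +-cong (fromℕ-+ 1 m) (-‿cong (fromℕ-+ 1 n)) ⟨
    fromℕ (suc m) - fromℕ (suc n)             ∎

  fromℤ-+ : ∀ i j → fromℤ (i ℤ.+ j) ≈ fromℤ i + fromℤ j
  fromℤ-+ (+ m)    (+ n)    = fromℕ-+ m n
  fromℤ-+ (+ m)    -[1+ n ] = fromℤ-⊖ m (suc n)
  fromℤ-+ -[1+ m ] (+ n)    = trans (fromℤ-⊖ n (suc m)) (+-comm _ _)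
  fromℤ-+ -[1+ m ] -[1+ n ] = begin
    - fromℕ (suc (suc (m N.+ n)))         ≡⟨ ≡.cong (λ k → - fromℕ (suc k)) (ℕₚ.+-suc m n) ⟨
    - fromℕ (suc m N.+ suc n)             ≈⟨ -‿cong (fromℕ-+ (suc m) (suc n)) ⟩
    - (fromℕ (suc m) + fromℕ (suc n))     ≈⟨ ⁻¹-∙-comm _ _ ⟨
    - fromℕ (suc m) - fromℕ (suc n)       ∎

  fromℤ-* : ∀ i j → fromℤ (i ℤ.* j) ≈ fromℤ i * fromℤ j
  fromℤ-* (+ m) (+ n) = trans (reflexive (≡.cong fromℤ (ℤₚ.+◃n≡+n (m N.* n)))) (fromℕ-* m n)
  fromℤ-* (+ m) -[1+ n ] = begin
    fromℤ (Sign.- ℤ.◃ m N.* suc n)    ≡⟨ ≡.cong fromℤ (ℤₚ.-◃n≡-n (m N.* suc n)) ⟩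
    fromℤ (ℤ.- (+ (m N.* suc n)))     ≈⟨ fromℤ-neg (+ (m N.* suc n)) ⟩
    - fromℕ (m N.* suc n)             ≈⟨ -‿cong (fromℕ-* m (suc n)) ⟩
    - (fromℕ m * fromℕ (suc n))       ≈⟨ -‿distribʳ-* _ _ ⟩
    fromℕ m * - fromℕ (suc n)         ∎
  fromℤ-* -[1+ m ] (+ n) = begin
    fromℤ (Sign.- ℤ.◃ suc m N.* n)    ≡⟨ ≡.cong fromℤ (ℤₚ.-◃n≡-n (suc m N.* n)) ⟩
    fromℤ (ℤ.- (+ (suc m N.* n)))     ≈⟨ fromℤ-neg (+ (suc m N.* n)) ⟩
    - fromℕ (suc m N.* n)             ≈⟨ -‿cong (fromℕ-* (suc m) n) ⟩
    - (fromℕ (suc m) * fromℕ n)       ≈⟨ -‿distribˡ-* _ _ ⟩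
    - fromℕ (suc m) * fromℕ n         ∎
  fromℤ-* -[1+ m ] -[1+ n ] = begin
    fromℕ (suc m N.* suc n)               ≈⟨ fromℕ-* (suc m) (suc n) ⟩
    fromℕ (suc m) * fromℕ (suc n)         ≈⟨ -‿involutive _ ⟨
    - - (fromℕ (suc m) * fromℕ (suc n))   ≈⟨ -‿cong (-‿distribʳ-* _ _) ⟩
    - (fromℕ (suc m) * - fromℕ (suc n))   ≈⟨ -‿distribˡ-* _ _ ⟩
    - fromℕ (suc m) * - fromℕ (suc n)     ∎

  fromℤ-morphism : ℤ.+-*-rawRing -Raw-AlmostCommutative⟶ fromCommutativeRing R
  fromℤ-morphism = record
    { ⟦_⟧    = fromℤ
    ; +-homo = fromℤ-+
    ; *-homo = fromℤ-*
    ; -‿homo = fromℤ-neg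
    ; 0-homo = refl
    ; 1-homo = refl
    }

  -- Coefficients are compared as integers: an equality found this way holds in every commutative
  -- ring, whatever its characteristic.
  _≟ᶜ_ : WeaklyDecidable (Induced-equivalence fromℤ-morphism)
  i ≟ᶜ j with i ℤ.≟ j
  ... | yes ≡.refl = just refl
  ... | no _       = nothing

  open import Algebra.Solver.Ring ℤ.+-*-rawRing (fromCommutativeRing R) fromℤ-morphism _≟ᶜ_ public

-- The Frobenius endomorphism

prime∣!⇒≤ : ∀ {p} → Prime p → ∀ n → p ∣ n ! → p ≤ n
prime∣!⇒≤ {p} pp zero p∣1 = ⊥-elim (ℕₚ.<⇒≱ (N.nonTrivial⇒n>1 p {{prime⇒nonTrivial pp}}) (∣⇒≤ p∣1))
prime∣!⇒≤ pp (suc n) p∣ with euclidsLemma (suc n) (n !) pp p∣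
... | inj₁ p∣1+n = ∣⇒≤ p∣1+n
... | inj₂ p∣n!  = ℕₚ.m≤n⇒m≤1+n (prime∣!⇒≤ pp n p∣n!)

-- In C(p,k) · k! (p - k)! = p! the prime divides the right side but neither factorial on the left,
-- since k and p - k are both below p.
prime∣binomial : ∀ {p k} → Prime p → 0 < k → k < p → p ∣ p Comb.C k
prime∣binomial {p@(suc p-1)} {k} pp 0<k k<p with euclidsLemma (p Comb.C k) (k ! N.* (p ∸ k) !) pp p∣prod
  where
  instance _ = k ℕₚ.!* (p ∸ k) !≢0
  p∣prod : p ∣ (p Comb.C k) N.* (k ! N.* (p ∸ k) !)
  p∣prod = ≡.subst (p ∣_)
    (≡.sym (≡.trans (≡.cong (N._* (k ! N.* (p ∸ k) !)) (Comb.nCk≡n!/k![n-k]! (ℕₚ.<⇒≤ k<p))) (m/n*n≡m (Comb.k![n∸k]!∣n! (ℕₚ.<⇒≤ k<p)))))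
    (m∣m*n (p-1 !))
... | inj₁ p∣C = p∣C
... | inj₂ p∣prod with euclidsLemma (k !) ((p ∸ k) !) pp p∣prod
...   | inj₁ p∣k! = ⊥-elim (ℕₚ.<⇒≱ k<p (prime∣!⇒≤ pp k p∣k!))
...   | inj₂ p∣   = ⊥-elim (ℕₚ.<⇒≱ (ℕₚ.∸-monoʳ-< 0<k (ℕₚ.<⇒≤ k<p)) (prime∣!⇒≤ pp (p ∸ k) p∣))

module Frobenius {c ℓ} (R : CommutativeRing c ℓ) where
  open CommutativeRing R hiding (zero)
  open import Algebra.Properties.Semiring.Exp semiring using (_^_; ^-congˡ; ^-assocʳ)
  open import Algebra.Properties.Semiring.Mult semiring using (_×_; ×-congˡ; ×-congʳ; ×-assocˡ; ×-assoc-*; ×-homo-1)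
  open import Algebra.Properties.Semiring.Sum semiring using (sum; sum-cong-≋; sum-init-last; sum-replicate-zero)
  open import Algebra.Properties.CommutativeSemiring.Binomial commutativeSemiring using (theorem; binomialTerm)
  open import Relation.Binary.Reasoning.Setoid setoid

  module _ {p} (prime : Prime p) (p×1≈0 : p × 1# ≈ 0#) where

    p∣n⇒n×x≈0 : ∀ {n} x → p ∣ n → n × x ≈ 0#
    p∣n⇒n×x≈0 x (divides k ≡.refl) = begin
      (k N.* p) × x     ≈⟨ ×-congˡ (ℕₚ.*-comm k p) ⟩
      (p N.* k) × x     ≈⟨ ×-assocˡ x p k ⟨
      p × (k × x)       ≈⟨ ×-congʳ p (*-identityˡ _) ⟨
      p × (1# * k × x)  ≈⟨ ×-assoc-* p 1# (k × x) ⟨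
      p × 1# * k × x    ≈⟨ *-congʳ p×1≈0 ⟩
      0# * k × x        ≈⟨ zeroˡ _ ⟩
      0#                ∎

    -- Every interior term of the binomial expansion has a coefficient divisible by p, so only the
    -- two end terms survive. The auxiliary `go` exposes the exponent as a successor, which is what
    -- allows the first and last summands to be split off.
    freshman : ∀ x y → (x + y) ^ p ≈ x ^ p + y ^ p
    freshman x y = go p ≡.refl
      where
      go : ∀ n → n ≡ p → (x + y) ^ n ≈ x ^ n + y ^ n
      go zero ≡.refl with () ← N.nonTrivial⇒n>1 p {{prime⇒nonTrivial prime}}
      go (suc m) ≡.refl = begin
        (x + y) ^ p                   ≈⟨ theorem p x y ⟩
        t zero + sum t⁺               ≈⟨ +-congˡ (sum-init-last t⁺) ⟩
        t zero + (sum (λ i → t⁺ (inject₁ i)) + t⁺ (Fin.fromℕ m))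
                                      ≈⟨ +-cong first (+-cong middle last) ⟩
        y ^ p + (0# + x ^ p)          ≈⟨ +-congˡ (+-identityˡ _) ⟩
        y ^ p + x ^ p                 ≈⟨ +-comm _ _ ⟩
        x ^ p + y ^ p                 ∎
        where
        t : Fin (suc p) → Carrier
        t = binomialTerm x y p
        t⁺ : Fin p → Carrier
        t⁺ i = t (suc i)
        first : t zero ≈ y ^ p
        first = trans (×-homo-1 _) (*-identityˡ _)
        last : t⁺ (Fin.fromℕ m) ≈ x ^ p
        last = begin
          (p Comb.C suc (toℕ (Fin.fromℕ m))) × (x ^ suc (toℕ (Fin.fromℕ m)) * y ^ (m ∸ toℕ (Fin.fromℕ m)))
            ≡⟨ ≡.cong (λ k → (p Comb.C suc k) × (x ^ suc k * y ^ (m ∸ k))) (Finₚ.toℕ-fromℕ m) ⟩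
          (p Comb.C p) × (x ^ p * y ^ (m ∸ m))
            ≡⟨ ≡.cong₂ (λ k l → k × (x ^ p * y ^ l)) (Comb.nCn≡1 p) (ℕₚ.n∸n≡0 m) ⟩
          1 × (x ^ p * 1#)  ≈⟨ ×-homo-1 _ ⟩
          x ^ p * 1#        ≈⟨ *-identityʳ _ ⟩
          x ^ p             ∎
        middle : sum (λ i → t⁺ (inject₁ i)) ≈ 0#
        middle = trans
          (sum-cong-≋ λ i → p∣n⇒n×x≈0 _ (prime∣binomial prime (s≤s z≤n)
            (s≤s (≡.subst (_< m) (≡.sym (Finₚ.toℕ-inject₁ i)) (Finₚ.toℕ<n i)))))
          (sum-replicate-zero m)

    freshman-power : ∀ k x y → (x + y) ^ (p N.^ k) ≈ x ^ (p N.^ k) + y ^ (p N.^ k)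
    freshman-power zero    x y = begin
      (x + y) * 1#      ≈⟨ distribʳ 1# x y ⟩
      x * 1# + y * 1#   ∎
    freshman-power (suc k) x y = begin
      (x + y) ^ (p N.* p N.^ k)                       ≈⟨ ^-assocʳ (x + y) p (p N.^ k) ⟨
      ((x + y) ^ p) ^ (p N.^ k)                       ≈⟨ ^-congˡ (p N.^ k) (freshman x y) ⟩
      (x ^ p + y ^ p) ^ (p N.^ k)                     ≈⟨ freshman-power k _ _ ⟩
      (x ^ p) ^ (p N.^ k) + (y ^ p) ^ (p N.^ k)       ≈⟨ +-cong (^-assocʳ x p (p N.^ k)) (^-assocʳ y p (p N.^ k)) ⟩
      x ^ (p N.* p N.^ k) + y ^ (p N.* p N.^ k)       ∎

open import Data.Product using (Σ; ∃; ∃₂; _×_; _,_; proj₁; proj₂)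
open import Data.Product.Properties using (≡-dec)
open ≡ using (refl; sym; trans; cong; cong₂; subst; setoid; isEquivalence; module ≡-Reasoning)

-- Counting

module _ where

  private variable
    A B : Set
    P Q : A → Set
    m n : ℕ

  HasCard-resp-⇔ : (∀ x → P x ⇔ Q x) → HasCard A P n → HasCard A Q n
  HasCard-resp-⇔ P⇔Q (xs , u , h , len) = xs , u , (λ x → mk⇔
    (Equivalence.to (P⇔Q x) ∘ Equivalence.to (h x))
    (Equivalence.from (h x) ∘ Equivalence.from (P⇔Q x))) , len

  HasCard-singleton : (a : A) → HasCard A (_≡ a) 1
  HasCard-singleton a = a ∷ [] , [] ∷ [] , (λ x → mk⇔ (λ { (here x≡a) → x≡a }) here) , refl

  HasCard-insert : (a : A) → ¬ P a → HasCard A P n → HasCard A (λ x → x ≡ a ⊎ P x) (suc n)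
  HasCard-insert {P = P} a ¬Pa (xs , u , h , len) =
    a ∷ xs
    , All.tabulate (λ y∈xs a≡y → ¬Pa (subst P (sym a≡y) (Equivalence.to (h _) y∈xs))) ∷ u
    , (λ x → mk⇔ (λ { (here x≡a) → inj₁ x≡a ; (there x∈xs) → inj₂ (Equivalence.to (h x) x∈xs) })
                 (λ { (inj₁ x≡a) → here x≡a ; (inj₂ Px) → there (Equivalence.from (h x) Px) }))
    , cong suc len

  HasCard-image : (f : A → B) → (∀ {x y} → f x ≡ f y → x ≡ y) →
                  HasCard A P n → HasCard B (λ y → ∃ λ x → P x × y ≡ f x) n
  HasCard-image {P = P} f f-inj (xs , u , h , len) =
    map f xs , Unique.map⁺ f-inj u
    , (λ y → mk⇔ (λ y∈ → let x , x∈xs , y≡fx = ∈-map⁻ f y∈ in x , Equivalence.to (h x) x∈xs , y≡fx)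
                 (λ { (x , Px , refl) → ∈-map⁺ f (Equivalence.from (h x) Px) }))
    , trans (Listₚ.length-map f xs) len

  length-cartesianProduct : (xs : List A) (ys : List B) →
                            length (cartesianProduct xs ys) ≡ length xs N.* length ys
  length-cartesianProduct []       ys = refl
  length-cartesianProduct (x ∷ xs) ys = trans (Listₚ.length-++ (map (x ,_) ys))
    (cong₂ N._+_ (Listₚ.length-map (x ,_) ys) (length-cartesianProduct xs ys))

  HasCard-× : HasCard A P m → HasCard B Q n →
              HasCard (A × B) (λ z → P (proj₁ z) × Q (proj₂ z)) (m N.* n)
  HasCard-× (xs , u , h , len) (ys , v , k , len′) =
    cartesianProduct xs ys , Unique.cartesianProduct⁺ u v
    , (λ { (x , y) → mk⇔
        (λ xy∈ → let x∈xs , y∈ys = ∈-cartesianProduct⁻ xs ys xy∈ in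
                 Equivalence.to (h x) x∈xs , Equivalence.to (k y) y∈ys)
        (λ { (Px , Qy) → ∈-cartesianProduct⁺ (Equivalence.from (h x) Px) (Equivalence.from (k y) Qy) }) })
    , trans (length-cartesianProduct xs ys) (cong₂ N._*_ len len′)

  -- The pigeonhole principle. The head of `xs` is cut out of `ys`; since it does not recur in the
  -- tail, the tail still lies in what remains.
  Unique-⊆⇒length≤ : {xs ys : List A} → Unique xs → (∀ {x} → x ∈ xs → x ∈ ys) → length xs ≤ length ys
  Unique-⊆⇒length≤ {xs = []}     _       _   = z≤n
  Unique-⊆⇒length≤ {xs = x ∷ xs} u@(_ ∷ u′) sub with ∈-∃++ (sub (here refl))
  ... | as , bs , refl = begin
    suc (length xs)              ≤⟨ s≤s (Unique-⊆⇒length≤ u′ sub′) ⟩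
    suc (length (as ++ bs))      ≡⟨ cong suc (Listₚ.length-++ as) ⟩
    suc (length as N.+ length bs)  ≡⟨ ℕₚ.+-suc (length as) (length bs) ⟨
    length as N.+ suc (length bs)  ≡⟨ Listₚ.length-++ as ⟨
    length (as ++ x ∷ bs)        ∎
    where
    open ℕₚ.≤-Reasoning
    sub′ : ∀ {y} → y ∈ xs → y ∈ as ++ bs
    sub′ y∈xs with ∈-++⁻ as (sub (there y∈xs))
    ... | inj₁ y∈as         = ∈-++⁺ˡ y∈as
    ... | inj₂ (here refl)  = ⊥-elim (Unique.Unique[x∷xs]⇒x∉xs u y∈xs)
    ... | inj₂ (there y∈bs) = ∈-++⁺ʳ as y∈bs

-- Finite fields

module FieldProperties {q : ℕ} (K : FiniteField q) where
  open FiniteField K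

  commutativeRing : CommutativeRing 0ℓ 0ℓ
  commutativeRing = record { isCommutativeRing = isCommutativeRing }

  open CommutativeRing commutativeRing using (_-_)
  open CommutativeRing commutativeRing public
    using (+-identityˡ; +-identityʳ; +-assoc; +-comm; *-identityˡ; *-identityʳ; *-assoc; *-comm;
           zeroˡ; zeroʳ; distribˡ; -‿inverseʳ; -‿inverseˡ; semiring; ring;
           +-isCommutativeMonoid; *-isCommutativeMonoid)
  open IntegerSolver commutativeRing public
    using (solve; _:=_; _:+_; _:*_; _:-_; :-_; con; Polynomial)
  open import Algebra.Properties.Semiring.Exp semiring public using (_^_)
  open import Algebra.Properties.Semiring.Mult semiring public using (×1-homo-*) renaming (_×_ to infixr 8 _·_)
  open import Algebra.Properties.Ring ring public using (-‿involutive; -0#≈0#; x∙y⁻¹≈ε⇒x≈y; +-cancelʳ; +-cancelˡ; -‿injective)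

  -- Consequences of finiteness

  elements : List Carrier
  elements = proj₁ card

  elements-unique : Unique elements
  elements-unique = proj₁ (proj₂ card)

  ∈-elements : ∀ x → x ∈ elements
  ∈-elements x = Equivalence.from (proj₁ (proj₂ (proj₂ card)) x) tt

  length-elements : length elements ≡ q
  length-elements = proj₂ (proj₂ (proj₂ card))

  x*y≡0⇒x≡0∨y≡0 : ∀ x y → x * y ≡ 0# → x ≡ 0# ⊎ y ≡ 0#
  x*y≡0⇒x≡0∨y≡0 x y xy≡0 with x ≟ 0#
  ... | yes x≡0 = inj₁ x≡0
  ... | no x≢0 with z , xz≡1 ← inverse x x≢0 = inj₂ (begin
    y            ≡⟨ *-identityˡ y ⟨
    1# * y       ≡⟨ cong (_* y) xz≡1 ⟨
    x * z * y    ≡⟨ solve 3 (λ x y z → x :* z :* y := z :* (x :* y)) refl x y z ⟩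
    z * (x * y)  ≡⟨ cong (z *_) xy≡0 ⟩
    z * 0#       ≡⟨ zeroʳ z ⟩
    0#           ∎)
    where open ≡-Reasoning

  x≢0∧x*y≡0⇒y≡0 : ∀ {x y} → x ≢ 0# → x * y ≡ 0# → y ≡ 0#
  x≢0∧x*y≡0⇒y≡0 {x} {y} x≢0 xy≡0 with x*y≡0⇒x≡0∨y≡0 x y xy≡0
  ... | inj₁ x≡0 = ⊥-elim (x≢0 x≡0)
  ... | inj₂ y≡0 = y≡0

  x≢0∧y≢0⇒x*y≢0 : ∀ {x y} → x ≢ 0# → y ≢ 0# → x * y ≢ 0#
  x≢0∧y≢0⇒x*y≢0 x≢0 y≢0 xy≡0 = y≢0 (x≢0∧x*y≡0⇒y≡0 x≢0 xy≡0)

  x*x≡0⇒x≡0 : ∀ {x} → x * x ≡ 0# → x ≡ 0#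
  x*x≡0⇒x≡0 {x} xx≡0 with x*y≡0⇒x≡0∨y≡0 x x xx≡0
  ... | inj₁ x≡0 = x≡0
  ... | inj₂ x≡0 = x≡0

  *-cancelˡ-nonZero : ∀ {x y z} → x ≢ 0# → x * y ≡ x * z → y ≡ z
  *-cancelˡ-nonZero {x} {y} {z} x≢0 xy≡xz = x∙y⁻¹≈ε⇒x≈y y z (x≢0∧x*y≡0⇒y≡0 x≢0 (begin
    x * (y - z)    ≡⟨ solve 3 (λ x y z → x :* (y :- z) := x :* y :- x :* z) refl x y z ⟩
    x * y - x * z  ≡⟨ cong (_- x * z) xy≡xz ⟩
    x * z - x * z  ≡⟨ -‿inverseʳ _ ⟩
    0#             ∎))
    where open ≡-Reasoning

  x*x≡y*y⇒x≡y∨x≡-y : ∀ x y → x * x ≡ y * y → x ≡ y ⊎ x ≡ - y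
  x*x≡y*y⇒x≡y∨x≡-y x y xx≡yy with x*y≡0⇒x≡0∨y≡0 (x - y) (x + y) (begin
    (x - y) * (x + y)  ≡⟨ solve 2 (λ x y → (x :- y) :* (x :+ y) := x :* x :- y :* y) refl x y ⟩
    x * x - y * y      ≡⟨ cong (_- y * y) xx≡yy ⟩
    y * y - y * y      ≡⟨ -‿inverseʳ _ ⟩
    0#                 ∎)
    where open ≡-Reasoning
  ... | inj₁ x-y≡0 = inj₁ (x∙y⁻¹≈ε⇒x≈y x y x-y≡0)
  ... | inj₂ x+y≡0 = inj₂ (x∙y⁻¹≈ε⇒x≈y x (- y) (trans (cong (x +_) (-‿involutive y)) x+y≡0))

  infix 9 _⁻¹
  -- Totalised by the value 0 at 0, so that inverses can stand in formulas and be passed to the ring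
  -- solver as plain variables. Everything known about them comes from `*-inverseʳ`.
  _⁻¹ : Carrier → Carrier
  x ⁻¹ with x ≟ 0#
  ... | yes _  = 0#
  ... | no x≢0 = proj₁ (inverse x x≢0)

  *-inverseʳ : ∀ {x} → x ≢ 0# → x * x ⁻¹ ≡ 1#
  *-inverseʳ {x} x≢0 with x ≟ 0#
  ... | yes x≡0 = ⊥-elim (x≢0 x≡0)
  ... | no x≢0 = proj₂ (inverse x x≢0)

  ^-nonZero : ∀ {x} n → x ≢ 0# → x ^ n ≢ 0#
  ^-nonZero zero    x≢0 = 0≢1 ∘ sym
  ^-nonZero (suc n) x≢0 = x≢0∧y≢0⇒x*y≢0 x≢0 (^-nonZero n x≢0)

  -- Two lists without repetition and with the same members are permutations of each other. This
  -- lets a commutative fold over `xs` be compared with the fold over its image.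
  bijection⇒↭ : ∀ {xs : List Carrier} {f g : Carrier → Carrier} → Unique xs →
                (∀ {x y} → f x ≡ f y → x ≡ y) →
                (∀ {x} → x ∈ xs → f x ∈ xs) → (∀ {x} → x ∈ xs → g x ∈ xs × f (g x) ≡ x) →
                map f xs ↭ xs
  bijection⇒↭ {xs} {f} {g} u f-inj f-∈ g-∈ = ∼bag⇒↭ (unique∧set⇒bag (Unique.map⁺ f-inj u) u (mk⇔
    (λ y∈ → let x , x∈ , y≡fx = ∈-map⁻ f y∈ in subst (_∈ xs) (sym y≡fx) (f-∈ x∈))
    (λ y∈ → let gy∈ , fgy≡y = g-∈ y∈ in subst (_∈ map f xs) fgy≡y (∈-map⁺ f gy∈))))

  sum-shift : ∀ xs → foldr _+_ 0# (map (1# +_) xs) ≡ length xs · 1# + foldr _+_ 0# xs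
  sum-shift []       = sym (+-identityˡ 0#)
  sum-shift (x ∷ xs) = begin
    1# + x + foldr _+_ 0# (map (1# +_) xs)            ≡⟨ cong (1# + x +_) (sum-shift xs) ⟩
    1# + x + (length xs · 1# + foldr _+_ 0# xs)       ≡⟨ solve 4 (λ o x n s → o :+ x :+ (n :+ s) := o :+ n :+ (x :+ s)) refl 1# x _ _ ⟩
    1# + length xs · 1# + (x + foldr _+_ 0# xs)       ∎
    where open ≡-Reasoning

  -- Translation by 1 permutes the field, so it preserves the sum of all elements.
  q·1≡0 : q · 1# ≡ 0#
  q·1≡0 = +-cancelʳ (foldr _+_ 0# elements) (q · 1#) 0# (begin
    q · 1# + foldr _+_ 0# elements                ≡⟨ cong (λ n → n · 1# + foldr _+_ 0# elements) length-elements ⟨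
    length elements · 1# + foldr _+_ 0# elements  ≡⟨ sum-shift elements ⟨
    foldr _+_ 0# (map (1# +_) elements)           ≡⟨ foldr-commMonoid (setoid Carrier) +-isCommutativeMonoid (↭⇒↭ₛ shift↭) ⟩
    foldr _+_ 0# elements                         ≡⟨ +-identityˡ _ ⟨
    0# + foldr _+_ 0# elements                    ∎)
    where
    open ≡-Reasoning
    shift↭ : map (1# +_) elements ↭ elements
    shift↭ = bijection⇒↭ {g = λ x → x - 1#} elements-unique (+-cancelˡ 1# _ _)
      (λ _ → ∈-elements _)
      (λ {x} _ → ∈-elements _ , solve 2 (λ o x → o :+ (x :- o) := x) refl 1# x)

  -- The map n ↦ n · 1 is multiplicative, so (p · 1)^k = q · 1 = 0, and a field has no nilpotent
  -- elements other than 0.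
  characteristic : ∀ {p} k → q ≡ p N.^ k → p · 1# ≡ 0#
  characteristic {p} k q≡p^k with (p · 1#) ≟ 0#
  ... | yes p·1≡0 = p·1≡0
  ... | no p·1≢0  = ⊥-elim (^-nonZero k p·1≢0 (begin
    (p · 1#) ^ k     ≡⟨ powers k ⟨
    (p N.^ k) · 1#   ≡⟨ cong (_· 1#) q≡p^k ⟨
    q · 1#           ≡⟨ q·1≡0 ⟩
    0#               ∎))
    where
    open ≡-Reasoning
    powers : ∀ k → (p N.^ k) · 1# ≡ (p · 1#) ^ k
    powers zero    = +-identityʳ 1#
    powers (suc k) = trans (×1-homo-* p (p N.^ k)) (cong (p · 1# *_) (powers k))

  nonZeros : List Carrier
  nonZeros = filter (λ x → ¬? (x ≟ 0#)) elements

  ∈-nonZeros⁺ : ∀ {x} → x ≢ 0# → x ∈ nonZeros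
  ∈-nonZeros⁺ {x} x≢0 = ∈-filter⁺ (λ x → ¬? (x ≟ 0#)) (∈-elements x) x≢0

  ∈-nonZeros⁻ : ∀ {x} → x ∈ nonZeros → x ≢ 0#
  ∈-nonZeros⁻ x∈ = proj₂ (∈-filter⁻ (λ x → ¬? (x ≟ 0#)) {xs = elements} x∈)

  nonZeros-unique : Unique nonZeros
  nonZeros-unique = Unique.filter⁺ (λ x → ¬? (x ≟ 0#)) elements-unique

  -- Stated with `suc` instead of q - 1, so that rewriting the exponent q makes c^q unfold to c
  -- times a power.
  1+length-nonZeros : suc (length nonZeros) ≡ q
  1+length-nonZeros = trans (ℕₚ.≤-antisym
    (Unique-⊆⇒length≤ {xs = 0# ∷ nonZeros}
      (proj₁ (proj₂ (HasCard-insert {P = _≢ 0#} 0# (λ 0≢0 → 0≢0 refl)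
        (nonZeros , nonZeros-unique , (λ x → mk⇔ ∈-nonZeros⁻ ∈-nonZeros⁺) , refl))))
      (λ _ → ∈-elements _))
    (Unique-⊆⇒length≤ elements-unique λ {x} _ → split x)) length-elements
    where
    split : ∀ x → x ∈ 0# ∷ nonZeros
    split x with x ≟ 0#
    ... | yes x≡0 = Any.here x≡0
    ... | no x≢0  = Any.there (∈-nonZeros⁺ x≢0)

  product-scale : ∀ c xs → foldr _*_ 1# (map (c *_) xs) ≡ c ^ length xs * foldr _*_ 1# xs
  product-scale c []       = sym (*-identityˡ 1#)
  product-scale c (x ∷ xs) = begin
    c * x * foldr _*_ 1# (map (c *_) xs)          ≡⟨ cong (c * x *_) (product-scale c xs) ⟩
    c * x * (c ^ length xs * foldr _*_ 1# xs)     ≡⟨ solve 4 (λ c x n s → c :* x :* (n :* s) := c :* n :* (x :* s)) refl c x _ _ ⟩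
    c * c ^ length xs * (x * foldr _*_ 1# xs)     ∎
    where open ≡-Reasoning

  product-nonZero : ∀ {xs} → (∀ {x} → x ∈ xs → x ≢ 0#) → foldr _*_ 1# xs ≢ 0#
  product-nonZero {[]}     _    = 0≢1 ∘ sym
  product-nonZero {x ∷ xs} xs≢0 = x≢0∧y≢0⇒x*y≢0 (xs≢0 (Any.here refl)) (product-nonZero (xs≢0 ∘ Any.there))

  -- Multiplication by c ≠ 0 permutes the nonzero elements, so it preserves their product.
  x^q≡x : ∀ x → x ^ q ≡ x
  x^q≡x c with c ≟ 0#
  ... | yes refl = subst (λ n → 0# ^ n ≡ 0#) 1+length-nonZeros (zeroˡ _)
  ... | no c≢0 = subst (λ n → c ^ n ≡ c) 1+length-nonZeros (begin
    c * c ^ length nonZeros  ≡⟨ cong (c *_) (*-cancelˡ-nonZero (product-nonZero ∈-nonZeros⁻) (begin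
      Π * c ^ length nonZeros            ≡⟨ *-comm _ _ ⟩
      c ^ length nonZeros * Π            ≡⟨ product-scale c nonZeros ⟨
      foldr _*_ 1# (map (c *_) nonZeros) ≡⟨ foldr-commMonoid (setoid Carrier) *-isCommutativeMonoid (↭⇒↭ₛ scale↭) ⟩
      Π                                  ≡⟨ *-identityʳ _ ⟨
      Π * 1#                             ∎)) ⟩
    c * 1#                   ≡⟨ *-identityʳ c ⟩
    c                        ∎)
    where
    open ≡-Reasoning
    Π = foldr _*_ 1# nonZeros
    c⁻¹≢0 : c ⁻¹ ≢ 0#
    c⁻¹≢0 c⁻¹≡0 = 0≢1 (trans (sym (zeroʳ c)) (trans (cong (c *_) (sym c⁻¹≡0)) (*-inverseʳ c≢0)))
    scale↭ : map (c *_) nonZeros ↭ nonZeros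
    scale↭ = bijection⇒↭ {g = c ⁻¹ *_} nonZeros-unique (*-cancelˡ-nonZero c≢0)
      (λ x∈ → ∈-nonZeros⁺ (x≢0∧y≢0⇒x*y≢0 c≢0 (∈-nonZeros⁻ x∈)))
      (λ {x} x∈ → ∈-nonZeros⁺ (x≢0∧y≢0⇒x*y≢0 c⁻¹≢0 (∈-nonZeros⁻ x∈))
        , trans (sym (*-assoc c (c ⁻¹) x)) (trans (cong (_* x) (*-inverseʳ c≢0)) (*-identityˡ x)))

  -- Squares in a field of odd order

  module OddOrder (q-odd : q % 2 ≡ 1) where

    q≢m+m : ∀ m → q ≢ m N.+ m
    q≢m+m m q≡m+m = ℕₚ.0≢1+n (trans (sym (m*n%n≡0 m 2)) (trans (cong (_% 2) (trans m*2≡m+m (sym q≡m+m))) q-odd))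
      where
      m*2≡m+m : m N.* 2 ≡ m N.+ m
      m*2≡m+m = trans (ℕₚ.*-comm m 2) (cong (m N.+_) (ℕₚ.+-identityʳ m))

    -- If 2 = 0, all even multiples of 1 vanish, so the odd multiple q · 1 equals 1; but it is 0.
    1+1≢0 : 1# + 1# ≢ 0#
    1+1≢0 2≡0 = 0≢1 (sym (begin
      1#                                       ≡⟨ solve 0 (con 1ℤ := con 1ℤ :+ con 0ℤ) refl ⟩
      1# + 0#                                  ≡⟨ cong (1# +_) (even (q / 2)) ⟨
      (1 N.+ (q / 2) N.* 2) · 1#               ≡⟨ cong (λ r → (r N.+ (q / 2) N.* 2) · 1#) q-odd ⟨
      (q % 2 N.+ (q / 2) N.* 2) · 1#           ≡⟨ cong (_· 1#) (m≡m%n+[m/n]*n q 2) ⟨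
      q · 1#                                   ≡⟨ q·1≡0 ⟩
      0#                                       ∎))
      where
      open ≡-Reasoning
      even : ∀ m → (m N.* 2) · 1# ≡ 0#
      even zero    = refl
      even (suc m) = begin
        1# + (1# + (m N.* 2) · 1#)  ≡⟨ +-assoc _ _ _ ⟨
        1# + 1# + (m N.* 2) · 1#    ≡⟨ cong₂ _+_ 2≡0 (even m) ⟩
        0# + 0#                     ≡⟨ +-identityˡ 0# ⟩
        0#                          ∎

    square? : ∀ x → Dec (Any.Any (λ y → x ≡ y * y) elements)
    square? x = any? (λ y → x ≟ (y * y)) elements

    squares : List Carrier
    squares = filter square? elements

    ∈-squares⁺ : ∀ y → y * y ∈ squares
    ∈-squares⁺ y = ∈-filter⁺ square? (∈-elements (y * y)) (lose (∈-elements y) refl)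

    ∈-squares⁻ : ∀ {x} → x ∈ squares → ∃ λ y → x ≡ y * y
    ∈-squares⁻ x∈ = Any.satisfied (proj₂ (∈-filter⁻ square? {xs = elements} x∈))

    squares-unique : Unique squares
    squares-unique = Unique.filter⁺ square? elements-unique

    √ : Carrier → Carrier
    √ x with square? x
    ... | yes sq = proj₁ (Any.satisfied sq)
    -- A filler for nonsquares; the root is only ever taken of squares.
    ... | no _   = 0#

    √-square : ∀ y → y * y ≡ √ (y * y) * √ (y * y)
    √-square y with square? (y * y)
    ... | yes sq  = proj₂ (Any.satisfied sq)
    ... | no ¬sq = ⊥-elim (¬sq (lose (∈-elements y) refl))

    -- Every element is ± the chosen root of its square; oddness of q makes the inequality strict.
    q<2∣squares∣ : q < length squares N.+ length squares
    q<2∣squares∣ = ℕₚ.≤∧≢⇒< (begin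
      q                                                         ≡⟨ length-elements ⟨
      length elements                                           ≤⟨ Unique-⊆⇒length≤ elements-unique (λ {x} _ → ±√ x) ⟩
      length (map √ squares ++ map (λ s → - √ s) squares)       ≡⟨ Listₚ.length-++ (map √ squares) ⟩
      length (map √ squares) N.+ length (map (λ s → - √ s) squares) ≡⟨ cong₂ N._+_ (Listₚ.length-map _ squares) (Listₚ.length-map _ squares) ⟩
      length squares N.+ length squares                         ∎) (q≢m+m (length squares))
      where
      open ℕₚ.≤-Reasoning
      ±√ : ∀ x → x ∈ map √ squares ++ map (λ s → - √ s) squares
      ±√ x with x*x≡y*y⇒x≡y∨x≡-y x (√ (x * x)) (√-square x)
      ... | inj₁ x≡√  = ∈-++⁺ˡ (subst (_∈ map √ squares) (sym x≡√) (∈-map⁺ √ (∈-squares⁺ x)))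
      ... | inj₂ x≡-√ = ∈-++⁺ʳ (map √ squares) (subst (_∈ map (λ s → - √ s) squares) (sym x≡-√) (∈-map⁺ (λ s → - √ s) (∈-squares⁺ x)))

    -- The sets {s²} and {c - d t²} both have more than q/2 elements, so they meet.
    s²+dt²≡c-solvable : ∀ c d → d ≢ 0# → ∃₂ λ s t → s * s + d * (t * t) ≡ c
    s²+dt²≡c-solvable c d d≢0 with any? (λ y → square? (c - d * (y * y))) elements
    ... | yes sol with t , sq ← Any.satisfied sol with s , eq ← Any.satisfied sq =
      s , t , trans (cong (_+ d * (t * t)) (sym eq)) (solve 2 (λ c u → c :- u :+ u := c) refl c (d * (t * t)))
    ... | no ¬sol = ⊥-elim (ℕₚ.<⇒≱ q<2∣squares∣ (begin
      length squares N.+ length squares           ≡⟨ cong (length squares N.+_) (Listₚ.length-map f squares) ⟨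
      length squares N.+ length (map f squares)   ≡⟨ Listₚ.length-++ squares ⟨
      length (squares ++ map f squares)           ≤⟨ Unique-⊆⇒length≤
        (Unique.++⁺ squares-unique (Unique.map⁺ f-injective squares-unique) disjoint) (λ _ → ∈-elements _) ⟩
      length elements                             ≡⟨ length-elements ⟩
      q                                           ∎))
      where
      open ℕₚ.≤-Reasoning
      f : Carrier → Carrier
      f x = c - d * x
      f-injective : ∀ {x y} → f x ≡ f y → x ≡ y
      f-injective eq = *-cancelˡ-nonZero d≢0 (-‿injective (+-cancelˡ c _ _ eq))
      disjoint : ∀ {x} → x ∈ squares × x ∈ map f squares → ⊥
      disjoint (x∈ , x∈′) with ∈-map⁻ f x∈′
      ... | y , y∈ , refl with s , eq ← ∈-squares⁻ x∈ | t , refl ← ∈-squares⁻ y∈ =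
        ¬sol (lose (∈-elements t) (lose (∈-elements s) eq))

-- The quadratic extension

module QuadraticExtension {q : ℕ} (K : FiniteField q) (δ : FiniteField.Carrier K)
                          (δ-nonsquare : ∀ t → FiniteField._*_ K t t ≢ δ) where
  open Setting K δ
  open FieldProperties K

  F2-isCommutativeRing : IsCommutativeRing _≡_ _+₂_ _*₂_ neg₂ 0₂ 1₂
  F2-isCommutativeRing = record
    { isRing = record
      { +-isAbelianGroup = record
        { isGroup = record
          { isMonoid = record
            { isSemigroup = record
              { isMagma = record { isEquivalence = isEquivalence ; ∙-cong = cong₂ _+₂_ }
              ; assoc = λ _ _ _ → cong₂ _,_ (+-assoc _ _ _) (+-assoc _ _ _) }
            ; identity = (λ _ → cong₂ _,_ (+-identityˡ _) (+-identityˡ _))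
                       , (λ _ → cong₂ _,_ (+-identityʳ _) (+-identityʳ _)) }
          ; inverse = (λ _ → cong₂ _,_ (-‿inverseˡ _) (-‿inverseˡ _))
                    , (λ _ → cong₂ _,_ (-‿inverseʳ _) (-‿inverseʳ _))
          ; ⁻¹-cong = cong neg₂ }
        ; comm = λ _ _ → cong₂ _,_ (+-comm _ _) (+-comm _ _) }
      ; *-cong = cong₂ _*₂_
      ; *-assoc = λ { (x₀ , x₁) (y₀ , y₁) (z₀ , z₁) → cong₂ _,_
          (solve 7 (λ x₀ x₁ y₀ y₁ z₀ z₁ d →
            (x₀ :* y₀ :+ d :* (x₁ :* y₁)) :* z₀ :+ d :* ((x₀ :* y₁ :+ x₁ :* y₀) :* z₁)
            := x₀ :* (y₀ :* z₀ :+ d :* (y₁ :* z₁)) :+ d :* (x₁ :* (y₀ :* z₁ :+ y₁ :* z₀)))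
            refl x₀ x₁ y₀ y₁ z₀ z₁ δ)
          (solve 7 (λ x₀ x₁ y₀ y₁ z₀ z₁ d →
            (x₀ :* y₀ :+ d :* (x₁ :* y₁)) :* z₁ :+ (x₀ :* y₁ :+ x₁ :* y₀) :* z₀
            := x₀ :* (y₀ :* z₁ :+ y₁ :* z₀) :+ x₁ :* (y₀ :* z₀ :+ d :* (y₁ :* z₁)))
            refl x₀ x₁ y₀ y₁ z₀ z₁ δ) }
      ; *-identity = (λ x → trans (*₂-comm 1₂ x) (*₂-identityʳ x)) , *₂-identityʳ
      ; distrib = *₂-distribˡ , (λ x y z → trans (*₂-comm (y +₂ z) x) (trans (*₂-distribˡ x y z) (cong₂ _+₂_ (*₂-comm x y) (*₂-comm x z)))) }
    ; *-comm = *₂-comm }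
    where
    *₂-comm : ∀ x y → x *₂ y ≡ y *₂ x
    *₂-comm (x₀ , x₁) (y₀ , y₁) = cong₂ _,_
      (cong₂ _+_ (*-comm _ _) (cong (δ *_) (*-comm _ _)))
      (trans (+-comm _ _) (cong₂ _+_ (*-comm _ _) (*-comm _ _)))
    *₂-identityʳ : ∀ x → x *₂ 1₂ ≡ x
    *₂-identityʳ (x₀ , x₁) = cong₂ _,_
      (solve 3 (λ x₀ x₁ d → x₀ :* con 1ℤ :+ d :* (x₁ :* con 0ℤ) := x₀) refl x₀ x₁ δ)
      (solve 2 (λ x₀ x₁ → x₀ :* con 0ℤ :+ x₁ :* con 1ℤ := x₁) refl x₀ x₁)
    *₂-distribˡ : ∀ x y z → x *₂ (y +₂ z) ≡ x *₂ y +₂ x *₂ z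
    *₂-distribˡ (x₀ , x₁) (y₀ , y₁) (z₀ , z₁) = cong₂ _,_
      (solve 7 (λ x₀ x₁ y₀ y₁ z₀ z₁ d → x₀ :* (y₀ :+ z₀) :+ d :* (x₁ :* (y₁ :+ z₁))
        := x₀ :* y₀ :+ d :* (x₁ :* y₁) :+ (x₀ :* z₀ :+ d :* (x₁ :* z₁))) refl x₀ x₁ y₀ y₁ z₀ z₁ δ)
      (solve 6 (λ x₀ x₁ y₀ y₁ z₀ z₁ → x₀ :* (y₁ :+ z₁) :+ x₁ :* (y₀ :+ z₀)
        := x₀ :* y₁ :+ x₁ :* y₀ :+ (x₀ :* z₁ :+ x₁ :* z₀)) refl x₀ x₁ y₀ y₁ z₀ z₁)

  F2-commutativeRing : CommutativeRing 0ℓ 0ℓ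
  F2-commutativeRing = record { isCommutativeRing = F2-isCommutativeRing }

  module F2ᵣ = CommutativeRing F2-commutativeRing
  module F2ₛ = IntegerSolver F2-commutativeRing

  1₂≢0₂ : 1₂ ≢ 0₂
  1₂≢0₂ 1≡0 = 0≢1 (sym (cong proj₁ 1≡0))

  conj : F2 → F2
  conj (x₀ , x₁) = x₀ , - x₁

  norm : F2 → Carrier
  norm (x₀ , x₁) = sq x₀ - δ * sq x₁

  x*conj : ∀ x → x *₂ conj x ≡ (norm x , 0#)
  x*conj (x₀ , x₁) = cong₂ _,_
    (solve 3 (λ x₀ x₁ d → x₀ :* x₀ :+ d :* (x₁ :* (:- x₁)) := x₀ :* x₀ :- d :* (x₁ :* x₁)) refl x₀ x₁ δ)
    (solve 2 (λ x₀ x₁ → x₀ :* (:- x₁) :+ x₁ :* x₀ := con 0ℤ) refl x₀ x₁)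

  -- Brahmagupta's identity.
  norm-* : ∀ x y → norm (x *₂ y) ≡ norm x * norm y
  norm-* (x₀ , x₁) (y₀ , y₁) = solve 5 (λ x₀ x₁ y₀ y₁ d →
    let sq = λ u → u :* u in
    sq (x₀ :* y₀ :+ d :* (x₁ :* y₁)) :- d :* sq (x₀ :* y₁ :+ x₁ :* y₀)
    := (sq x₀ :- d :* sq x₁) :* (sq y₀ :- d :* sq y₁)) refl x₀ x₁ y₀ y₁ δ

  norm-1₂ : norm 1₂ ≡ 1#
  norm-1₂ = solve 1 (λ d → con 1ℤ :* con 1ℤ :- d :* (con 0ℤ :* con 0ℤ) := con 1ℤ) refl δ

  norm-0₂ : norm 0₂ ≡ 0#
  norm-0₂ = solve 1 (λ d → con 0ℤ :* con 0ℤ :- d :* (con 0ℤ :* con 0ℤ) := con 0ℤ) refl δ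

  -- A zero of x₀² - δ x₁² with x₁ ≠ 0 would exhibit δ as the square of x₀/x₁. This is where the
  -- quadratic extension becomes a field.
  norm≡0⇒≡0₂ : ∀ x → norm x ≡ 0# → x ≡ 0₂
  norm≡0⇒≡0₂ (x₀ , x₁) N≡0 with x₁ ≟ 0#
  ... | yes refl = cong (_, 0#) (x*x≡0⇒x≡0 (trans
    (solve 2 (λ x₀ d → x₀ :* x₀ := x₀ :* x₀ :- d :* (con 0ℤ :* con 0ℤ)) refl x₀ δ) N≡0))
  ... | no x₁≢0 = ⊥-elim (δ-nonsquare (x₀ * x₁ ⁻¹) (begin
    x₀ * x₁ ⁻¹ * (x₀ * x₁ ⁻¹)
      ≡⟨ solve 4 (λ x₀ x₁ y d → x₀ :* y :* (x₀ :* y)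
           := (x₀ :* x₀ :- d :* (x₁ :* x₁)) :* (y :* y) :+ d :* (x₁ :* y) :* (x₁ :* y)) refl x₀ x₁ (x₁ ⁻¹) δ ⟩
    norm (x₀ , x₁) * (x₁ ⁻¹ * x₁ ⁻¹) + δ * (x₁ * x₁ ⁻¹) * (x₁ * x₁ ⁻¹)
      ≡⟨ cong₂ (λ u v → u * (x₁ ⁻¹ * x₁ ⁻¹) + δ * v * v) N≡0 (*-inverseʳ x₁≢0) ⟩
    0# * (x₁ ⁻¹ * x₁ ⁻¹) + δ * 1# * 1#
      ≡⟨ solve 2 (λ y d → con 0ℤ :* y :+ d :* con 1ℤ :* con 1ℤ := d) refl _ δ ⟩
    δ ∎))
    where open ≡-Reasoning

  x≢0₂⇒norm≢0 : ∀ {x} → x ≢ 0₂ → norm x ≢ 0#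
  x≢0₂⇒norm≢0 {x} x≢0 = x≢0 ∘ norm≡0⇒≡0₂ x

  -- Multiplicativity of the norm transfers the absence of zero divisors from F_q.
  x≢0₂∧x*y≡0₂⇒y≡0₂ : ∀ {x y} → x ≢ 0₂ → x *₂ y ≡ 0₂ → y ≡ 0₂
  x≢0₂∧x*y≡0₂⇒y≡0₂ {x} {y} x≢0 xy≡0 = norm≡0⇒≡0₂ y (x≢0∧x*y≡0⇒y≡0 (x≢0₂⇒norm≢0 x≢0)
    (trans (sym (norm-* x y)) (trans (cong norm xy≡0) norm-0₂)))

  infix 9 _⁻¹₂
  _⁻¹₂ : F2 → F2
  x ⁻¹₂ = conj x *₂ (norm x ⁻¹ , 0#)

  *₂-inverseʳ : ∀ {x} → x ≢ 0₂ → x *₂ x ⁻¹₂ ≡ 1₂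
  *₂-inverseʳ {x} x≢0 = begin
    x *₂ (conj x *₂ (norm x ⁻¹ , 0#))   ≡⟨ F2ᵣ.*-assoc x (conj x) _ ⟨
    x *₂ conj x *₂ (norm x ⁻¹ , 0#)     ≡⟨ cong (_*₂ (norm x ⁻¹ , 0#)) (x*conj x) ⟩
    (norm x , 0#) *₂ (norm x ⁻¹ , 0#)   ≡⟨ cong₂ _,_
      (solve 3 (λ n m d → n :* m :+ d :* (con 0ℤ :* con 0ℤ) := n :* m) refl (norm x) (norm x ⁻¹) δ)
      (solve 2 (λ n m → n :* con 0ℤ :+ con 0ℤ :* m := con 0ℤ) refl (norm x) (norm x ⁻¹)) ⟩
    (norm x * norm x ⁻¹ , 0#)           ≡⟨ cong (_, 0#) (*-inverseʳ (x≢0₂⇒norm≢0 x≢0)) ⟩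
    1₂                                  ∎
    where open ≡-Reasoning

  x*[x⁻¹*y]≡y : ∀ {x} y → x ≢ 0₂ → x *₂ (x ⁻¹₂ *₂ y) ≡ y
  x*[x⁻¹*y]≡y {x} y x≢0 = trans (sym (F2ᵣ.*-assoc x (x ⁻¹₂) y))
    (trans (cong (_*₂ y) (*₂-inverseʳ x≢0)) (F2ᵣ.*-identityˡ y))

  *₂-cancelˡ-nonZero : ∀ {x y z} → x ≢ 0₂ → x *₂ y ≡ x *₂ z → y ≡ z
  *₂-cancelˡ-nonZero {x} {y} {z} x≢0 xy≡xz = begin
    y                    ≡⟨ F2ₛ.solve 2 (λ y z → y F2ₛ.:= (y F2ₛ.:- z) F2ₛ.:+ z) refl y z ⟩
    (y -₂ z) +₂ z        ≡⟨ cong (_+₂ z) (x≢0₂∧x*y≡0₂⇒y≡0₂ x≢0 (begin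
      x *₂ (y -₂ z)        ≡⟨ F2ₛ.solve 3 (λ x y z → x F2ₛ.:* (y F2ₛ.:- z) F2ₛ.:= x F2ₛ.:* y F2ₛ.:- x F2ₛ.:* z) refl x y z ⟩
      x *₂ y -₂ x *₂ z     ≡⟨ cong (_-₂ x *₂ z) xy≡xz ⟩
      x *₂ z -₂ x *₂ z     ≡⟨ F2ᵣ.-‿inverseʳ _ ⟩
      0₂                   ∎)) ⟩
    0₂ +₂ z              ≡⟨ F2ᵣ.+-identityˡ z ⟩
    z                    ∎
    where open ≡-Reasoning

  open Exp F2ᵣ.semiring using () renaming (_^_ to _^ₛ_)

  ^₂≡^ₛ : ∀ x n → x ^₂ n ≡ x ^ₛ n
  ^₂≡^ₛ x zero    = refl
  ^₂≡^ₛ x (suc n) = cong (x *₂_) (^₂≡^ₛ x n)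

  embed-^ : ∀ c n → (c , 0#) ^₂ n ≡ (c ^ n , 0#)
  embed-^ c zero    = refl
  embed-^ c (suc n) = trans (cong ((c , 0#) *₂_) (embed-^ c n)) (cong₂ _,_
    (solve 3 (λ c x d → c :* x :+ d :* (con 0ℤ :* con 0ℤ) := c :* x) refl c (c ^ n) δ)
    (solve 2 (λ c x → c :* con 0ℤ :+ con 0ℤ :* x := con 0ℤ) refl c (c ^ n)))

  ε² : ε *₂ ε ≡ (δ , 0#)
  ε² = cong₂ _,_
    (solve 1 (λ d → con 0ℤ :* con 0ℤ :+ d :* (con 1ℤ :* con 1ℤ) := d) refl δ)
    (solve 0 (con 0ℤ :* con 1ℤ :+ con 1ℤ :* con 0ℤ := con 0ℤ) refl)

  -- The Frobenius map of F_{q²}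

  module _ {p} k (p-prime : Prime p) (q≡p^k : q ≡ p N.^ k) (ε^q≡-ε : ε ^₂ q ≡ neg₂ ε) where

    open Mult F2ᵣ.semiring using () renaming (_×_ to infixr 8 _·₂_)

    ·₂-1₂ : ∀ n → n ·₂ 1₂ ≡ (n · 1# , 0#)
    ·₂-1₂ zero    = refl
    ·₂-1₂ (suc n) = trans (cong (1₂ +₂_) (·₂-1₂ n)) (cong (1# + n · 1# ,_) (+-identityˡ 0#))

    -- Split x = x₀ + ε x₁. The power q is additive because q is a power of the characteristic, it
    -- fixes x₀ and x₁ because they lie in F_q, and it negates ε by hypothesis.
    ^₂q≡conj : ∀ x → x ^₂ q ≡ conj x
    ^₂q≡conj x@(x₀ , x₁) = begin
      x ^₂ q                                         ≡⟨ ^₂≡^ₛ x q ⟩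
      x ^ₛ q                                         ≡⟨ cong₂ _^ₛ_ split q≡p^k ⟩
      ((x₀ , 0#) +₂ ε *₂ (x₁ , 0#)) ^ₛ (p N.^ k)     ≡⟨ Frobenius.freshman-power F2-commutativeRing p-prime
                                                          (trans (·₂-1₂ p) (cong (_, 0#) (characteristic k q≡p^k))) k _ _ ⟩
      (x₀ , 0#) ^ₛ (p N.^ k) +₂ (ε *₂ (x₁ , 0#)) ^ₛ (p N.^ k)
                                                     ≡⟨ cong (λ n → (x₀ , 0#) ^ₛ n +₂ (ε *₂ (x₁ , 0#)) ^ₛ n) q≡p^k ⟨
      (x₀ , 0#) ^ₛ q +₂ (ε *₂ (x₁ , 0#)) ^ₛ q        ≡⟨ cong ((x₀ , 0#) ^ₛ q +₂_) (CommutativeExp.^-distrib-* F2ᵣ.commutativeSemiring ε (x₁ , 0#) q) ⟩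
      (x₀ , 0#) ^ₛ q +₂ ε ^ₛ q *₂ (x₁ , 0#) ^ₛ q     ≡⟨ cong₂ _+₂_ (base x₀) (cong₂ _*₂_ (trans (sym (^₂≡^ₛ ε q)) ε^q≡-ε) (base x₁)) ⟩
      (x₀ , 0#) +₂ neg₂ ε *₂ (x₁ , 0#)               ≡⟨ cong₂ _,_
        (solve 3 (λ x₀ x₁ d → x₀ :+ ((:- con 0ℤ) :* x₁ :+ d :* ((:- con 1ℤ) :* con 0ℤ)) := x₀) refl x₀ x₁ δ)
        (solve 1 (λ x₁ → con 0ℤ :+ ((:- con 0ℤ) :* con 0ℤ :+ (:- con 1ℤ) :* x₁) := :- x₁) refl x₁) ⟩
      conj x                                         ∎
      where
      open ≡-Reasoning
      split : x ≡ (x₀ , 0#) +₂ ε *₂ (x₁ , 0#)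
      split = cong₂ _,_
        (solve 3 (λ x₀ x₁ d → x₀ := x₀ :+ (con 0ℤ :* x₁ :+ d :* (con 1ℤ :* con 0ℤ))) refl x₀ x₁ δ)
        (solve 1 (λ x₁ → x₁ := con 0ℤ :+ (con 0ℤ :* con 0ℤ :+ con 1ℤ :* x₁)) refl x₁)
      base : ∀ c → (c , 0#) ^ₛ q ≡ (c , 0#)
      base c = trans (sym (^₂≡^ₛ (c , 0#) q)) (trans (embed-^ c q) (cong (_, 0#) (x^q≡x c)))

    ^₂[1+q]≡norm : ∀ x → x ^₂ suc q ≡ (norm x , 0#)
    ^₂[1+q]≡norm x = trans (cong (x *₂_) (^₂q≡conj x)) (x*conj x)

  δ≢0 : δ ≢ 0#
  δ≢0 δ≡0 = δ-nonsquare 0# (trans (zeroˡ 0#) (sym δ≡0))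

  -- Elements of prescribed norm

  module _ (1+1≢0 : 1# + 1# ≢ 0#) where

    -- Hilbert 90: apart from 1, the elements of norm 1 are (t + ε)/(t - ε), t ∈ F_q.
    unit-inv : Carrier → Carrier
    unit-inv t = (sq t - δ) ⁻¹

    unit-inv-inverse : ∀ t → (sq t - δ) * unit-inv t ≡ 1#
    unit-inv-inverse t = *-inverseʳ (δ-nonsquare t ∘ x∙y⁻¹≈ε⇒x≈y _ _)

    -- Extending the fraction (t + ε)/(t - ε) by t + ε gives (t² + δ + 2tε)/(t² - δ). Writing its
    -- first component as 1 + 2δ/(t² - δ) makes the distance from 1 visible, which serves both
    -- `unit≢1₂` and injectivity.
    unit : Carrier → F2
    unit t = (1# + two * δ * unit-inv t) , (two * t * unit-inv t)

    2δ≢0 : two * δ ≢ 0#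
    2δ≢0 = x≢0∧y≢0⇒x*y≢0 1+1≢0 δ≢0

    unit-inv≢0 : ∀ t → unit-inv t ≢ 0#
    unit-inv≢0 t w≡0 = 0≢1 (trans (sym (zeroʳ _)) (trans (cong ((sq t - δ) *_) (sym w≡0)) (unit-inv-inverse t)))

    unit≢1₂ : ∀ t → 1₂ ≢ unit t
    unit≢1₂ t eq = x≢0∧y≢0⇒x*y≢0 2δ≢0 (unit-inv≢0 t)
      (+-cancelˡ 1# _ _ (trans (sym (cong proj₁ eq)) (sym (+-identityʳ 1#))))

    -- The first components determine 1/(t² - δ); once these agree, the second components determine
    -- t.
    unit-injective : ∀ {s t} → unit s ≡ unit t → s ≡ t
    unit-injective {s} {t} eq = *-cancelˡ-nonZero (x≢0∧y≢0⇒x*y≢0 1+1≢0 (unit-inv≢0 t)) (begin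
      two * unit-inv t * s   ≡⟨ solve 3 (λ c w s → c :* w :* s := c :* s :* w) refl two (unit-inv t) s ⟩
      two * s * unit-inv t   ≡⟨ cong (two * s *_) w≡ ⟨
      two * s * unit-inv s   ≡⟨ cong proj₂ eq ⟩
      two * t * unit-inv t   ≡⟨ solve 3 (λ c w s → c :* s :* w := c :* w :* s) refl two (unit-inv t) t ⟩
      two * unit-inv t * t   ∎)
      where
      open ≡-Reasoning
      w≡ : unit-inv s ≡ unit-inv t
      w≡ = *-cancelˡ-nonZero 2δ≢0 (+-cancelˡ 1# _ _ (cong proj₁ eq))

    norm-unit : ∀ t → norm (unit t) ≡ 1#
    norm-unit t = begin
      norm (unit t)
        ≡⟨ solve 3 (λ t w d → let c = con 1ℤ :+ con 1ℤ ; sq = λ u → u :* u in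
             sq (con 1ℤ :+ c :* d :* w) :- d :* sq (c :* t :* w)
             := con 1ℤ :+ c :* c :* d :* w :* (con 1ℤ :- (sq t :- d) :* w)) refl t w δ ⟩
      1# + two * two * δ * w * (1# - (sq t - δ) * w)
        ≡⟨ cong (λ u → 1# + two * two * δ * w * (1# - u)) (unit-inv-inverse t) ⟩
      1# + two * two * δ * w * (1# - 1#)
        ≡⟨ solve 1 (λ x → con 1ℤ :+ x :* (con 1ℤ :- con 1ℤ) := con 1ℤ) refl _ ⟩
      1# ∎
      where
      open ≡-Reasoning
      w = unit-inv t

    -- Points of the conic s² - δ r² = 1 are projected from (1,0). If s = 1, the equation leaves δ
    -- r² = 0; otherwise the slope r/(s - 1) recovers the parameter up to the factor δ. The `⊤` fits
    -- the predicate of `card`.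
    norm≡1⇒unit : ∀ x → norm x ≡ 1# → x ≡ 1₂ ⊎ ∃ λ t → ⊤ × x ≡ unit t
    norm≡1⇒unit (s , r) N≡1 with s ≟ 1#
    ... | yes refl = inj₁ (cong (1# ,_) (x*x≡0⇒x≡0 (x≢0∧x*y≡0⇒y≡0 δ≢0 (begin
      δ * (r * r)                      ≡⟨ solve 2 (λ r d → d :* (r :* r) := con 1ℤ :- (con 1ℤ :* con 1ℤ :- d :* (r :* r))) refl r δ ⟩
      1# - norm (1# , r)               ≡⟨ cong (λ u → 1# - u) N≡1 ⟩
      1# - 1#                          ≡⟨ -‿inverseʳ 1# ⟩
      0#                               ∎))))
      where open ≡-Reasoning
    ... | no s≢1 = inj₂ (t , tt , cong₂ _,_
      (begin
        s                    ≡⟨ solve 1 (λ s → s := con 1ℤ :+ (s :- con 1ℤ)) refl s ⟩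
        1# + (s - 1#)        ≡⟨ cong (1# +_) 2δw≡s-1 ⟨
        1# + two * δ * w     ∎)
      (begin
        r                        ≡⟨ *-identityʳ r ⟨
        r * 1#                   ≡⟨ cong (r *_) [s-1]e≡1 ⟨
        r * ((s - 1#) * e)       ≡⟨ cong (λ u → r * (u * e)) 2δw≡s-1 ⟨
        r * (two * δ * w * e)    ≡⟨ solve 4 (λ r w e d → let c = con 1ℤ :+ con 1ℤ in
                                      r :* (c :* d :* w :* e) := c :* (d :* r :* e) :* w) refl r w e δ ⟩
        two * t * w              ∎))
      where
      open ≡-Reasoning
      e = (s - 1#) ⁻¹
      -- Dividing the desired r = 2tw by s - 1 = 2δw forces t = δ r/(s - 1).
      t = δ * r * e
      w = unit-inv t
      [s-1]e≡1 : (s - 1#) * e ≡ 1#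
      [s-1]e≡1 = *-inverseʳ (s≢1 ∘ x∙y⁻¹≈ε⇒x≈y s 1#)
      t²-δ≡2δe : sq t - δ ≡ two * δ * e
      t²-δ≡2δe = begin
        sq t - δ
          -- The identity isolates the two available relations: 1 - N(s,r) vanishes, and E = (s -
          -- 1)e is 1.
          ≡⟨ solve 4 (λ s r e d → let c = con 1ℤ :+ con 1ℤ ; sq = λ u → u :* u ; E = (s :- con 1ℤ) :* e in
               sq (d :* r :* e) :- d
               := d :* sq e :* (con 1ℤ :- (sq s :- d :* sq r)) :+ d :* (E :* E :- con 1ℤ) :+ c :* d :* e :* E)
               refl s r e δ ⟩
        δ * sq e * (1# - norm (s , r)) + δ * (E * E - 1#) + two * δ * e * E
          ≡⟨ cong₂ (λ u v → δ * sq e * (1# - u) + δ * (v * v - 1#) + two * δ * e * v) N≡1 [s-1]e≡1 ⟩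
        δ * sq e * (1# - 1#) + δ * (1# * 1# - 1#) + two * δ * e * 1#
          ≡⟨ solve 3 (λ x d y → x :* (con 1ℤ :- con 1ℤ) :+ d :* (con 1ℤ :* con 1ℤ :- con 1ℤ) :+ y :* con 1ℤ := y) refl _ δ _ ⟩
        two * δ * e ∎
        where E = (s - 1#) * e
      2δw≡s-1 : two * δ * w ≡ s - 1#
      2δw≡s-1 = begin
        two * δ * w                         ≡⟨ *-identityʳ _ ⟨
        two * δ * w * 1#                    ≡⟨ cong (two * δ * w *_) [s-1]e≡1 ⟨
        two * δ * w * ((s - 1#) * e)        ≡⟨ solve 4 (λ c w u e → c :* w :* (u :* e) := u :* (c :* e :* w)) refl (two * δ) w (s - 1#) e ⟩
        (s - 1#) * (two * δ * e * w)        ≡⟨ cong (λ u → (s - 1#) * (u * w)) t²-δ≡2δe ⟨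
        (s - 1#) * ((sq t - δ) * w)         ≡⟨ cong ((s - 1#) *_) (unit-inv-inverse t) ⟩
        (s - 1#) * 1#                       ≡⟨ *-identityʳ _ ⟩
        s - 1#                              ∎

    card-norm≡1 : HasCard F2 (λ x → norm x ≡ 1#) (suc q)
    card-norm≡1 = HasCard-resp-⇔
      (λ x → mk⇔ (λ { (inj₁ refl) → norm-1₂ ; (inj₂ (t , _ , refl)) → norm-unit t }) (norm≡1⇒unit x))
      (HasCard-insert 1₂ (λ { (t , _ , eq) → unit≢1₂ t eq }) (HasCard-image unit unit-injective card))

    -- A nonempty fibre of the norm is a coset of the group of elements of norm 1.
    card-norm-fibre : ∀ u → u ≢ 0₂ → HasCard F2 (λ x → norm x ≡ norm u) (suc q)
    card-norm-fibre u u≢0 = HasCard-resp-⇔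
      (λ x → mk⇔
        (λ { (y , Ny≡1 , refl) → trans (norm-* u y) (trans (cong (norm u *_) Ny≡1) (*-identityʳ _)) })
        (λ Nx≡Nu → u ⁻¹₂ *₂ x
          , *-cancelˡ-nonZero (x≢0₂⇒norm≢0 u≢0) (begin
              norm u * norm (u ⁻¹₂ *₂ x)   ≡⟨ norm-* u _ ⟨
              norm (u *₂ (u ⁻¹₂ *₂ x))     ≡⟨ cong norm (x*[x⁻¹*y]≡y x u≢0) ⟩
              norm x                       ≡⟨ Nx≡Nu ⟩
              norm u                       ≡⟨ *-identityʳ _ ⟨
              norm u * 1#                  ∎)
          , sym (x*[x⁻¹*y]≡y x u≢0)))
      (HasCard-image (u *₂_) (*₂-cancelˡ-nonZero u≢0) card-norm≡1)
      where open ≡-Reasoning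

-- The cone

module _ {A : Set} {z o : A} where

  Normalized-uncons : ∀ {n x} {xs : Vec A n} → Normalized z o (x ∷ xs) → x ≡ o ⊎ (x ≡ z × Normalized z o xs)
  Normalized-uncons (here _)  = inj₁ refl
  Normalized-uncons (there v) = inj₂ (refl , v)

  Normalized-tail : ∀ {n x} {xs : Vec A n} → x ≢ o → Normalized z o (x ∷ xs) → Normalized z o xs
  Normalized-tail x≢o v with Normalized-uncons v
  ... | inj₁ x≡o     = ⊥-elim (x≢o x≡o)
  ... | inj₂ (_ , w) = w

module BinaryForm {q : ℕ} (K : FiniteField q) (δ : FiniteField.Carrier K) where
  open Setting K δ
  open FieldProperties K

  form : (A B C x y : Carrier) → Carrier
  form A B C x y = A * sq x + two * B * (x * y) + C * sq y

  -- Half the polar form of `form`; keeping the factor 2 outside shows where odd characteristic is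
  -- needed.
  bilin : (A B C x y x′ y′ : Carrier) → Carrier
  bilin A B C x y x′ y′ = A * (x * x′) + B * (x * y′ + y * x′) + C * (y * y′)

  form-+ : ∀ A B C x y x′ y′ → form A B C (x + x′) (y + y′) ≡
           form A B C x y + form A B C x′ y′ + two * bilin A B C x y x′ y′
  form-+ = solve 7 (λ A B C x y x′ y′ →
    let c = con 1ℤ :+ con 1ℤ
        form = λ x y → A :* (x :* x) :+ c :* B :* (x :* y) :+ C :* (y :* y) in
    form (x :+ x′) (y :+ y′) := form x y :+ form x′ y′
      :+ c :* (A :* (x :* x′) :+ B :* (x :* y′ :+ y :* x′) :+ C :* (y :* y′))) refl

  module _ {A B C : Carrier} (disc≢0 : A * C - B * B ≢ 0#) where

    -- Cramer's rule: multiplying the system by the adjugate matrix leaves the determinant times x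
    -- and times y.
    bilin-nondegenerate : ∀ x y → A * x + B * y ≡ 0# → B * x + C * y ≡ 0# → x ≡ 0# × y ≡ 0#
    bilin-nondegenerate x y e₁ e₂ =
      x≢0∧x*y≡0⇒y≡0 disc≢0 (begin
        (A * C - B * B) * x  ≡⟨ solve 5 (λ A B C x y → (A :* C :- B :* B) :* x := C :* (A :* x :+ B :* y) :- B :* (B :* x :+ C :* y)) refl A B C x y ⟩
        C * (A * x + B * y) - B * (B * x + C * y)  ≡⟨ cong₂ (λ u v → C * u - B * v) e₁ e₂ ⟩
        C * 0# - B * 0#      ≡⟨ zero-combination C B ⟩
        0#                   ∎) ,
      x≢0∧x*y≡0⇒y≡0 disc≢0 (begin
        (A * C - B * B) * y  ≡⟨ solve 5 (λ A B C x y → (A :* C :- B :* B) :* y := A :* (B :* x :+ C :* y) :- B :* (A :* x :+ B :* y)) refl A B C x y ⟩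
        A * (B * x + C * y) - B * (A * x + B * y)  ≡⟨ cong₂ (λ u v → A * u - B * v) e₂ e₁ ⟩
        A * 0# - B * 0#      ≡⟨ zero-combination A B ⟩
        0#                   ∎)
      where
      open ≡-Reasoning
      zero-combination : ∀ u v → u * 0# - v * 0# ≡ 0#
      zero-combination = solve 2 (λ u v → u :* con 0ℤ :- v :* con 0ℤ := con 0ℤ) refl

  -- J (x , y) = (- (B x + C y) , A x + B y) is orthogonal to (x , y) and scales the form by
  -- A C - B², so s + t J scales it by s² + (A C - B²) t².
  form-similitude : ∀ A B C s t x y →
    form A B C (x * (s - t * B) - y * (t * C)) (x * (t * A) + y * (s + t * B)) ≡
    (s * s + (A * C - B * B) * (t * t)) * form A B C x y
  form-similitude = solve 7 (λ A B C s t x y →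
    let form = λ x y → A :* (x :* x) :+ (con 1ℤ :+ con 1ℤ) :* B :* (x :* y) :+ C :* (y :* y) in
    form (x :* (s :- t :* B) :- y :* (t :* C)) (x :* (t :* A) :+ y :* (s :+ t :* B))
    := (s :* s :+ (A :* C :- B :* B) :* (t :* t)) :* form x y) refl

module Cone {q : ℕ} (K : FiniteField q) (δ : FiniteField.Carrier K) (a b : Setting.F2 K δ)
            (q-odd : q % 2 ≡ 1) where
  open Setting K δ
  open BM a b
  open FieldProperties K
  open OddOrder q-odd
  open BinaryForm K δ

  -- The coefficients of x₁² and x₂² after collecting terms in `QB`; x₃ and x₄ carry the same ones.
  -- With 2a₀ for the mixed term they give the binary form f, whose discriminant d is A C - a₀².
  A C : Carrier
  A = a₁ - b₁
  C = δ * (a₁ + b₁)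

  Q : (x₀ x₁ x₂ x₃ x₄ x₆ : Carrier) → Carrier
  Q x₀ x₁ x₂ x₃ x₄ x₆ = x₀ * x₆ + (form A a₀ C x₁ x₂ + form A a₀ C x₃ x₄)

  Q-bilin : (x₀ x₁ x₂ x₃ x₄ x₆ y₀ y₁ y₂ y₃ y₄ y₆ : Carrier) → Carrier
  Q-bilin x₀ x₁ x₂ x₃ x₄ x₆ y₀ y₁ y₂ y₃ y₄ y₆ =
    x₀ * y₆ + y₀ * x₆ + two * (bilin A a₀ C x₁ x₂ y₁ y₂ + bilin A a₀ C x₃ x₄ y₃ y₄)

  QBase≡Q : ∀ x₀ x₁ x₂ x₃ x₄ x₆ → QBase (x₀ ∷ x₁ ∷ x₂ ∷ x₃ ∷ x₄ ∷ x₆ ∷ []) ≡ Q x₀ x₁ x₂ x₃ x₄ x₆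
  QBase≡Q x₀ x₁ x₂ x₃ x₄ x₆ = solve 10 (λ x₀ x₁ x₂ x₃ x₄ x₆ a₀ a₁ b₁ d →
    let sq = λ x → x :* x
        c = con 1ℤ :+ con 1ℤ
        form = λ x y → (a₁ :- b₁) :* sq x :+ c :* a₀ :* (x :* y) :+ d :* (a₁ :+ b₁) :* sq y in
    x₀ :* x₆ :+ c :* a₀ :* (x₁ :* x₂ :+ x₃ :* x₄)
      :+ a₁ :* (sq x₁ :+ sq x₃ :+ d :* (sq x₂ :+ sq x₄))
      :- b₁ :* (sq x₁ :- d :* sq x₂ :+ sq x₃ :- d :* sq x₄)
    := x₀ :* x₆ :+ (form x₁ x₂ :+ form x₃ x₄)) refl x₀ x₁ x₂ x₃ x₄ x₆ a₀ a₁ b₁ δ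

  polar-Q : ∀ x₀ x₁ x₂ x₃ x₄ x₆ y₀ y₁ y₂ y₃ y₄ y₆ →
    polar QBase (x₀ ∷ x₁ ∷ x₂ ∷ x₃ ∷ x₄ ∷ x₆ ∷ []) (y₀ ∷ y₁ ∷ y₂ ∷ y₃ ∷ y₄ ∷ y₆ ∷ []) ≡
    Q-bilin x₀ x₁ x₂ x₃ x₄ x₆ y₀ y₁ y₂ y₃ y₄ y₆
  polar-Q x₀ x₁ x₂ x₃ x₄ x₆ y₀ y₁ y₂ y₃ y₄ y₆ = begin
    polar QBase (x₀ ∷ x₁ ∷ x₂ ∷ x₃ ∷ x₄ ∷ x₆ ∷ []) (y₀ ∷ y₁ ∷ y₂ ∷ y₃ ∷ y₄ ∷ y₆ ∷ [])
      ≡⟨ cong₂ _-_ (cong₂ _-_ (QBase≡Q _ _ _ _ _ _) (QBase≡Q _ _ _ _ _ _)) (QBase≡Q _ _ _ _ _ _) ⟩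
    Q (x₀ + y₀) (x₁ + y₁) (x₂ + y₂) (x₃ + y₃) (x₄ + y₄) (x₆ + y₆) - Q x₀ x₁ x₂ x₃ x₄ x₆ - Q y₀ y₁ y₂ y₃ y₄ y₆
      ≡⟨ cong₂ (λ u v → (x₀ + y₀) * (x₆ + y₆) + (u + v) - Q x₀ x₁ x₂ x₃ x₄ x₆ - Q y₀ y₁ y₂ y₃ y₄ y₆)
           (form-+ A a₀ C x₁ x₂ y₁ y₂) (form-+ A a₀ C x₃ x₄ y₃ y₄) ⟩
    _ ≡⟨ solve 10 (λ x₀ y₀ x₆ y₆ f g f′ g′ h k → let c = con 1ℤ :+ con 1ℤ in
           (x₀ :+ y₀) :* (x₆ :+ y₆) :+ (f :+ f′ :+ c :* h :+ (g :+ g′ :+ c :* k))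
             :- (x₀ :* x₆ :+ (f :+ g)) :- (y₀ :* y₆ :+ (f′ :+ g′))
           := x₀ :* y₆ :+ y₀ :* x₆ :+ c :* (h :+ k)) refl
           x₀ y₀ x₆ y₆ (form A a₀ C x₁ x₂) (form A a₀ C x₃ x₄) (form A a₀ C y₁ y₂) (form A a₀ C y₃ y₄)
           (bilin A a₀ C x₁ x₂ y₁ y₂) (bilin A a₀ C x₃ x₄ y₃ y₄) ⟩
    Q-bilin x₀ x₁ x₂ x₃ x₄ x₆ y₀ y₁ y₂ y₃ y₄ y₆ ∎
    where open ≡-Reasoning

  polar-V : ∀ x₅ y₀ y₁ y₂ y₃ y₄ y₅ y₆ →
    polar QB (0# ∷ 0# ∷ 0# ∷ 0# ∷ 0# ∷ x₅ ∷ 0# ∷ []) (y₀ ∷ y₁ ∷ y₂ ∷ y₃ ∷ y₄ ∷ y₅ ∷ y₆ ∷ []) ≡ 0#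
  -- `QB` does not read x₅, so its polar form unfolds to that of `QBase` on the vectors with this
  -- coordinate deleted.
  polar-V x₅ y₀ y₁ y₂ y₃ y₄ y₅ y₆ = trans (polar-Q 0# 0# 0# 0# 0# 0# y₀ y₁ y₂ y₃ y₄ y₆)
    (solve 9 (λ y₀ y₁ y₂ y₃ y₄ y₆ A B C → let o = con 0ℤ in
      o :* y₆ :+ y₀ :* o :+ (con 1ℤ :+ con 1ℤ) :*
        (A :* (o :* y₁) :+ B :* (o :* y₂ :+ o :* y₁) :+ C :* (o :* y₂) :+ (A :* (o :* y₃) :+ B :* (o :* y₄ :+ o :* y₃) :+ C :* (o :* y₄)))
      := o) refl y₀ y₁ y₂ y₃ y₄ y₆ A a₀ C)

  module _ (disc≢0 : A * C - a₀ * a₀ ≢ 0#) where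

    -- Pairing with the six unit vectors gives x₀ = x₆ = 0 and two 2 × 2 linear systems whose
    -- determinant is the discriminant of f.
    radical-trivial : ∀ x₀ x₁ x₂ x₃ x₄ x₆ →
      (∀ y₀ y₁ y₂ y₃ y₄ y₆ → Q-bilin x₀ x₁ x₂ x₃ x₄ x₆ y₀ y₁ y₂ y₃ y₄ y₆ ≡ 0#) →
      (x₀ ∷ x₁ ∷ x₂ ∷ x₃ ∷ x₄ ∷ x₆ ∷ []) ≡ zeroV
    radical-trivial x₀ x₁ x₂ x₃ x₄ x₆ h
      = all-zero e₀ (bilin-nondegenerate disc≢0 x₁ x₂ (half e₁) (half e₂))
                 (bilin-nondegenerate disc≢0 x₃ x₄ (half e₃) (half e₄)) e₆
      where
      all-zero : ∀ {x₀ x₁ x₂ x₃ x₄ x₆} → x₀ ≡ 0# → x₁ ≡ 0# × x₂ ≡ 0# → x₃ ≡ 0# × x₄ ≡ 0# → x₆ ≡ 0# →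
                 x₀ ∷ x₁ ∷ x₂ ∷ x₃ ∷ x₄ ∷ x₆ ∷ [] ≡ zeroV
      all-zero refl (refl , refl) (refl , refl) refl = refl
      half : ∀ {u} → two * u ≡ 0# → u ≡ 0#
      half = x≢0∧x*y≡0⇒y≡0 1+1≢0
      evaluate : ∀ {u} y₀ y₁ y₂ y₃ y₄ y₆ → u ≡ Q-bilin x₀ x₁ x₂ x₃ x₄ x₆ y₀ y₁ y₂ y₃ y₄ y₆ → u ≡ 0#
      evaluate y₀ y₁ y₂ y₃ y₄ y₆ eq = trans eq (h y₀ y₁ y₂ y₃ y₄ y₆)
      β : ∀ {n} (A B C x₀ x₁ x₂ x₃ x₄ x₆ y₀ y₁ y₂ y₃ y₄ y₆ : Polynomial n) → Polynomial n
      β A B C x₀ x₁ x₂ x₃ x₄ x₆ y₀ y₁ y₂ y₃ y₄ y₆ =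
        x₀ :* y₆ :+ y₀ :* x₆ :+ (con 1ℤ :+ con 1ℤ) :*
          (A :* (x₁ :* y₁) :+ B :* (x₁ :* y₂ :+ x₂ :* y₁) :+ C :* (x₂ :* y₂) :+ (A :* (x₃ :* y₃) :+ B :* (x₃ :* y₄ :+ x₄ :* y₃) :+ C :* (x₄ :* y₄)))
      e₀ : x₀ ≡ 0#
      e₀ = evaluate 0# 0# 0# 0# 0# 1# (solve 9 (λ A B C x₀ x₁ x₂ x₃ x₄ x₆ → let o = con 0ℤ ; i = con 1ℤ in
        x₀ := β A B C x₀ x₁ x₂ x₃ x₄ x₆ o o o o o i) refl A a₀ C x₀ x₁ x₂ x₃ x₄ x₆)
      e₆ : x₆ ≡ 0#
      e₆ = evaluate 1# 0# 0# 0# 0# 0# (solve 9 (λ A B C x₀ x₁ x₂ x₃ x₄ x₆ → let o = con 0ℤ ; i = con 1ℤ in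
        x₆ := β A B C x₀ x₁ x₂ x₃ x₄ x₆ i o o o o o) refl A a₀ C x₀ x₁ x₂ x₃ x₄ x₆)
      e₁ : two * (A * x₁ + a₀ * x₂) ≡ 0#
      e₁ = evaluate 0# 1# 0# 0# 0# 0# (solve 9 (λ A B C x₀ x₁ x₂ x₃ x₄ x₆ → let o = con 0ℤ ; i = con 1ℤ in
        (i :+ i) :* (A :* x₁ :+ B :* x₂) := β A B C x₀ x₁ x₂ x₃ x₄ x₆ o i o o o o) refl A a₀ C x₀ x₁ x₂ x₃ x₄ x₆)
      e₂ : two * (a₀ * x₁ + C * x₂) ≡ 0#
      e₂ = evaluate 0# 0# 1# 0# 0# 0# (solve 9 (λ A B C x₀ x₁ x₂ x₃ x₄ x₆ → let o = con 0ℤ ; i = con 1ℤ in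
        (i :+ i) :* (B :* x₁ :+ C :* x₂) := β A B C x₀ x₁ x₂ x₃ x₄ x₆ o o i o o o) refl A a₀ C x₀ x₁ x₂ x₃ x₄ x₆)
      e₃ : two * (A * x₃ + a₀ * x₄) ≡ 0#
      e₃ = evaluate 0# 0# 0# 1# 0# 0# (solve 9 (λ A B C x₀ x₁ x₂ x₃ x₄ x₆ → let o = con 0ℤ ; i = con 1ℤ in
        (i :+ i) :* (A :* x₃ :+ B :* x₄) := β A B C x₀ x₁ x₂ x₃ x₄ x₆ o o o i o o) refl A a₀ C x₀ x₁ x₂ x₃ x₄ x₆)
      e₄ : two * (a₀ * x₃ + C * x₄) ≡ 0#
      e₄ = evaluate 0# 0# 0# 0# 1# 0# (solve 9 (λ A B C x₀ x₁ x₂ x₃ x₄ x₆ → let o = con 0ℤ ; i = con 1ℤ in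
        (i :+ i) :* (B :* x₃ :+ C :* x₄) := β A B C x₀ x₁ x₂ x₃ x₄ x₆ o o o o i o) refl A a₀ C x₀ x₁ x₂ x₃ x₄ x₆)

    QBase-nondegenerate : Nondegenerate QBase
    QBase-nondegenerate (x₀ ∷ x₁ ∷ x₂ ∷ x₃ ∷ x₄ ∷ x₆ ∷ []) h =
      radical-trivial x₀ x₁ x₂ x₃ x₄ x₆ λ y₀ y₁ y₂ y₃ y₄ y₆ →
        trans (sym (polar-Q x₀ x₁ x₂ x₃ x₄ x₆ y₀ y₁ y₂ y₃ y₄ y₆)) (h (y₀ ∷ y₁ ∷ y₂ ∷ y₃ ∷ y₄ ∷ y₆ ∷ []))

    -- The radical of the base kills every coordinate but x₅, and normalisation then forces x₅ = 1.
    singular⇔V : ∀ v → NormalizedF v → ((QB v ≡ 0# × (∀ w → polar QB v w ≡ 0#)) ⇔ v ≡ V)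
    singular⇔V v@(x₀ ∷ x₁ ∷ x₂ ∷ x₃ ∷ x₄ ∷ x₅ ∷ x₆ ∷ []) v-normalized = mk⇔ to from
      where
      vertex : ∀ {x₀ x₁ x₂ x₃ x₄ x₅ x₆} → NormalizedF (x₀ ∷ x₁ ∷ x₂ ∷ x₃ ∷ x₄ ∷ x₅ ∷ x₆ ∷ []) →
               x₀ ∷ x₁ ∷ x₂ ∷ x₃ ∷ x₄ ∷ x₆ ∷ [] ≡ zeroV → x₀ ∷ x₁ ∷ x₂ ∷ x₃ ∷ x₄ ∷ x₅ ∷ x₆ ∷ [] ≡ V
      vertex n refl with Normalized-uncons (tail (tail (tail (tail (tail n)))))
        where
        tail : ∀ {n} {xs : Vec Carrier n} → NormalizedF (0# ∷ xs) → NormalizedF xs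
        tail = Normalized-tail 0≢1
      ... | inj₁ refl       = refl
      ... | inj₂ (_ , n₆) with () ← Normalized-tail 0≢1 n₆
      to : QB v ≡ 0# × (∀ w → polar QB v w ≡ 0#) → v ≡ V
      to (_ , h) = vertex v-normalized (radical-trivial x₀ x₁ x₂ x₃ x₄ x₆ (λ y₀ y₁ y₂ y₃ y₄ y₆ →
        trans (sym (polar-Q x₀ x₁ x₂ x₃ x₄ x₆ y₀ y₁ y₂ y₃ y₄ y₆)) (h (y₀ ∷ y₁ ∷ y₂ ∷ y₃ ∷ y₄ ∷ 0# ∷ y₆ ∷ []))))
      from : v ≡ V → QB v ≡ 0# × (∀ w → polar QB v w ≡ 0#)
      from refl = trans (QBase≡Q 0# 0# 0# 0# 0# 0#) (solve 3 (λ A B C →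
          let o = con 0ℤ ; f = A :* (o :* o) :+ (con 1ℤ :+ con 1ℤ) :* B :* (o :* o) :+ C :* (o :* o) in
          o :* o :+ (f :+ f) := o) refl A a₀ C)
        , λ { (y₀ ∷ y₁ ∷ y₂ ∷ y₃ ∷ y₄ ∷ y₅ ∷ y₆ ∷ []) → polar-V 1# y₀ y₁ y₂ y₃ y₄ y₅ y₆ }

    QBase-hyperbolic : HyperbolicPG5 QBase
    QBase-hyperbolic with s , t , s²+dt²≡-1 ← s²+dt²≡c-solvable (- 1#) (A * C - a₀ * a₀) disc≢0 =
      QBase-nondegenerate , u₁ , u₂ , u₃ , independent , singular
      where
      u₁ u₂ u₃ : Vec Carrier 6
      -- `u₁` and `u₂` are (v, Tv) for the two basis vectors v, with T = s + t J the similitude of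
      -- `form-similitude`; `u₃` spans the x₆-axis.
      u₁ = 0# ∷ 1# ∷ 0# ∷ s - t * a₀ ∷ t * A ∷ 0# ∷ []
      u₂ = 0# ∷ 0# ∷ 1# ∷ - (t * C) ∷ s + t * a₀ ∷ 0# ∷ []
      u₃ = 0# ∷ 0# ∷ 0# ∷ 0# ∷ 0# ∷ 1# ∷ []
      combination : ∀ l₁ l₂ l₃ → l₁ ⊙ u₁ ⊕ l₂ ⊙ u₂ ⊕ l₃ ⊙ u₃ ≡
        0# ∷ l₁ ∷ l₂ ∷ l₁ * (s - t * a₀) - l₂ * (t * C) ∷ l₁ * (t * A) + l₂ * (s + t * a₀) ∷ l₃ ∷ []
      combination l₁ l₂ l₃ =
        cong₂ _∷_ (solve 3 (λ l₁ l₂ l₃ → l₁ :* o :+ l₂ :* o :+ l₃ :* o := o) refl l₁ l₂ l₃)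
        (cong₂ _∷_ (solve 3 (λ l₁ l₂ l₃ → l₁ :* i :+ l₂ :* o :+ l₃ :* o := l₁) refl l₁ l₂ l₃)
        (cong₂ _∷_ (solve 3 (λ l₁ l₂ l₃ → l₁ :* o :+ l₂ :* i :+ l₃ :* o := l₂) refl l₁ l₂ l₃)
        (cong₂ _∷_ (solve 5 (λ l₁ l₂ l₃ u v → l₁ :* u :+ l₂ :* (:- v) :+ l₃ :* o := l₁ :* u :- l₂ :* v) refl l₁ l₂ l₃ _ _)
        (cong₂ _∷_ (solve 5 (λ l₁ l₂ l₃ u v → l₁ :* u :+ l₂ :* v :+ l₃ :* o := l₁ :* u :+ l₂ :* v) refl l₁ l₂ l₃ _ _)
        (cong₂ _∷_ (solve 3 (λ l₁ l₂ l₃ → l₁ :* o :+ l₂ :* o :+ l₃ :* i := l₃) refl l₁ l₂ l₃) refl)))))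
        where
        o i : ∀ {n} → Polynomial n
        o = con 0ℤ
        i = con 1ℤ
      independent : ∀ l₁ l₂ l₃ → l₁ ⊙ u₁ ⊕ l₂ ⊙ u₂ ⊕ l₃ ⊙ u₃ ≡ zeroV → (l₁ ≡ 0#) × (l₂ ≡ 0#) × (l₃ ≡ 0#)
      independent l₁ l₂ l₃ eq = coordinates (trans (sym (combination l₁ l₂ l₃)) eq)
        where
        coordinates : ∀ {x y} → 0# ∷ l₁ ∷ l₂ ∷ x ∷ y ∷ l₃ ∷ [] ≡ zeroV → (l₁ ≡ 0#) × (l₂ ≡ 0#) × (l₃ ≡ 0#)
        coordinates refl = refl , refl , refl
      singular : ∀ l₁ l₂ l₃ → QBase (l₁ ⊙ u₁ ⊕ l₂ ⊙ u₂ ⊕ l₃ ⊙ u₃) ≡ 0#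
      singular l₁ l₂ l₃ = begin
        QBase (l₁ ⊙ u₁ ⊕ l₂ ⊙ u₂ ⊕ l₃ ⊙ u₃)   ≡⟨ cong QBase (combination l₁ l₂ l₃) ⟩
        _                                       ≡⟨ QBase≡Q _ _ _ _ _ _ ⟩
        0# * l₃ + (f + form A a₀ C (l₁ * (s - t * a₀) - l₂ * (t * C)) (l₁ * (t * A) + l₂ * (s + t * a₀)))
          ≡⟨ cong (λ g → 0# * l₃ + (f + g)) (trans (form-similitude A a₀ C s t l₁ l₂) (cong (_* f) s²+dt²≡-1)) ⟩
        0# * l₃ + (f + - 1# * f)                ≡⟨ solve 2 (λ l f → con 0ℤ :* l :+ (f :+ (:- con 1ℤ) :* f) := con 0ℤ) refl l₃ f ⟩
        0#                                      ∎
        where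
        open ≡-Reasoning
        f = form A a₀ C l₁ l₂

-- Points at infinity

module _ where
  open ℕSolver.+-*-Solver

  1+[1+q]q²≡q³+q²+1 : ∀ q → suc (suc q N.* (q N.* q)) ≡ q N.^ 3 N.+ q N.^ 2 N.+ 1
  1+[1+q]q²≡q³+q²+1 = solve 1 (λ q →
    con 1 :+ (con 1 :+ q) :* (q :* q) := q :^ 3 :+ q :^ 2 :+ con 1) refl

  1+2q²≡2q²+1 : ∀ q → suc (2 N.* (q N.* q)) ≡ 2 N.* q N.^ 2 N.+ 1
  1+2q²≡2q²+1 = solve 1 (λ q → con 1 :+ con 2 :* (q :* q) := con 2 :* q :^ 2 :+ con 1) refl

module Infinity {q : ℕ} (K : FiniteField q) (δ : FiniteField.Carrier K)
                (δ-nonsquare : ∀ t → FiniteField._*_ K t t ≢ δ)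
                (q-odd : q % 2 ≡ 1)
                {p k : ℕ} (p-prime : Prime p) (q≡p^k : q ≡ p N.^ k)
                (ε^q≡-ε : Setting._^₂_ K δ (Setting.ε K δ) q ≡ Setting.neg₂ K δ (Setting.ε K δ))
                (a b : Setting.F2 K δ) where
  open Setting K δ
  open BM a b
  open FieldProperties K
  open OddOrder q-odd
  open QuadraticExtension K δ δ-nonsquare
  open F2ₛ using () renaming (solve to solve₂; _:=_ to _:=₂_; _:+_ to _:+₂_; _:*_ to _:*₂_; con to con₂)

  ^q+1≡norm : ∀ x → x ^₂ suc q ≡ (norm x , 0#)
  ^q+1≡norm = ^₂[1+q]≡norm k p-prime q≡p^k ε^q≡-ε

  -- The norms lie in F_q, so b multiplies them componentwise: only b₁ reaches the ε-component and
  -- b₀ drops out.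
  QB-affine : ∀ x y z → proj₂ (z +₂ a *₂ (x *₂ x +₂ y *₂ y) -₂ b *₂ ((norm x , 0#) +₂ (norm y , 0#)))
              ≡ QB (bcAff x y z)
  QB-affine (x₀ , x₁) (y₀ , y₁) (z₀ , z₁) = trans
    (solve 10 (λ x₀ x₁ y₀ y₁ z a₀ a₁ b₀ b₁ d →
      let N = λ u v → u :* u :- d :* (v :* v)
          o = con 0ℤ
          c = con 1ℤ :+ con 1ℤ
          sq = λ x → x :* x in
      z :+ (a₀ :* (x₀ :* x₁ :+ x₁ :* x₀ :+ (y₀ :* y₁ :+ y₁ :* y₀))
            :+ a₁ :* (x₀ :* x₀ :+ d :* (x₁ :* x₁) :+ (y₀ :* y₀ :+ d :* (y₁ :* y₁))))
        :+ (:- (b₀ :* (o :+ o) :+ b₁ :* (N x₀ x₁ :+ N y₀ y₁)))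
      := con 1ℤ :* z :+ c :* a₀ :* (x₀ :* x₁ :+ y₀ :* y₁)
        :+ a₁ :* (sq x₀ :+ sq y₀ :+ d :* (sq x₁ :+ sq y₁))
        :- b₁ :* (sq x₀ :- d :* sq x₁ :+ sq y₀ :- d :* sq y₁)) refl
      x₀ x₁ y₀ y₁ z₁ a₀ a₁ (proj₁ b) b₁ δ) refl

  InM-affine⇔QB : ∀ x y z → InM (1₂ ∷ x ∷ y ∷ z ∷ []) ⇔ (QB (bcAff x y z) ≡ 0#)
  InM-affine⇔QB x y z = mk⇔
    (λ { (inj₁ (_ , eq)) → trans (sym InM≡QB) eq ; (inj₂ (1≡0 , _)) → ⊥-elim (1₂≢0₂ 1≡0) })
    (λ eq → inj₁ (refl , trans InM≡QB eq))
    where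
    InM≡QB : proj₂ (z +₂ a *₂ (x *₂ x +₂ y *₂ y) -₂ b *₂ (x ^₂ suc q +₂ y ^₂ suc q)) ≡ QB (bcAff x y z)
    InM≡QB = trans
      (cong₂ (λ u v → proj₂ (z +₂ a *₂ (x *₂ x +₂ y *₂ y) -₂ b *₂ (u +₂ v))) (^q+1≡norm x) (^q+1≡norm y))
      (QB-affine x y z)

  -- Since b^q - b = -2ε b₁, the hypothesis reads 4(a₀² - δ a₁²) + 4δ b₁² ≠ 0, and the left side is
  -- -4 times the discriminant.
  discriminant≢0 : four₂ *₂ a ^₂ suc q +₂ (b ^₂ q -₂ b) ^₂ 2 ≢ 0₂ →
                   (a₁ - b₁) * (δ * (a₁ + b₁)) - a₀ * a₀ ≢ 0#
  discriminant≢0 h disc≡0 = h (begin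
    four₂ *₂ a ^₂ suc q +₂ (b ^₂ q -₂ b) ^₂ 2
      ≡⟨ cong₂ (λ u v → four₂ *₂ u +₂ (v -₂ b) ^₂ 2) (^q+1≡norm a) (^₂q≡conj k p-prime q≡p^k ε^q≡-ε b) ⟩
    four₂ *₂ (norm a , 0#) +₂ (conj b -₂ b) ^₂ 2
      ≡⟨ cong₂ _,_
        (solve 5 (λ a₀ a₁ b₀ b₁ d → let i = con 1ℤ ; o = con 0ℤ ; f = i :+ i :+ i :+ i ; z = o :+ o :+ o :+ o
                                        u = b₀ :- b₀ ; v = (:- b₁) :- b₁ in
          f :* (a₀ :* a₀ :- d :* (a₁ :* a₁)) :+ d :* (z :* o)
            :+ (u :* (u :* i :+ d :* (v :* o)) :+ d :* (v :* (u :* o :+ v :* i)))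
          := (:- f) :* ((a₁ :- b₁) :* (d :* (a₁ :+ b₁)) :- a₀ :* a₀)) refl a₀ a₁ (proj₁ b) b₁ δ)
        (solve 4 (λ n b₀ b₁ d → let i = con 1ℤ ; o = con 0ℤ ; f = i :+ i :+ i :+ i ; z = o :+ o :+ o :+ o
                                    u = b₀ :- b₀ ; v = (:- b₁) :- b₁ in
          f :* o :+ z :* n :+ (u :* (u :* o :+ v :* i) :+ v :* (u :* i :+ d :* (v :* o))) := o) refl (norm a) (proj₁ b) b₁ δ) ⟩
    (- (1# + 1# + 1# + 1#) * ((a₁ - b₁) * (δ * (a₁ + b₁)) - a₀ * a₀)) , 0#
      ≡⟨ cong (_, 0#) (trans (cong (- (1# + 1# + 1# + 1#) *_) disc≡0) (zeroʳ _)) ⟩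
    0₂ ∎)
    where open ≡-Reasoning

  pt∞ : Vec F2 4
  pt∞ = 0₂ ∷ 0₂ ∷ 0₂ ∷ 1₂ ∷ []

  pt : F2 × F2 → Vec F2 4
  pt (y , z) = 0₂ ∷ 1₂ ∷ y ∷ z ∷ []

  InM-infinity⇔norm : ∀ x y z → InM (0₂ ∷ x ∷ y ∷ z ∷ []) ⇔ (norm x + norm y ≡ 0#)
  InM-infinity⇔norm x y z = mk⇔
    (λ { (inj₁ (0≡1 , _)) → ⊥-elim (1₂≢0₂ (sym 0≡1)) ; (inj₂ (_ , eq)) → cong proj₁ (trans (sym eq′) eq) })
    (λ eq → inj₂ (refl , trans eq′ (cong₂ _,_ eq (+-identityˡ 0#))))
    where
    eq′ : x ^₂ suc q +₂ y ^₂ suc q ≡ (norm x + norm y , 0# + 0#)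
    eq′ = cong₂ _+₂_ (^q+1≡norm x) (^q+1≡norm y)

  norm[0₂]+norm≡0⇒≡0₂ : ∀ y → norm 0₂ + norm y ≡ 0# → y ≡ 0₂
  norm[0₂]+norm≡0⇒≡0₂ y eq = norm≡0⇒≡0₂ y
    (trans (sym (trans (cong (_+ norm y) norm-0₂) (+-identityˡ _))) eq)

  norm[1₂]+norm≡0⇔norm≡-1 : ∀ y → (norm 1₂ + norm y ≡ 0#) ⇔ (norm y ≡ - 1#)
  norm[1₂]+norm≡0⇔norm≡-1 y = mk⇔
    (λ eq → trans (solve 1 (λ n → n := con 1ℤ :+ n :- con 1ℤ) refl (norm y))
                  (trans (cong (_- 1#) (trans (cong (_+ norm y) (sym norm-1₂)) eq)) (+-identityˡ _)))
    (λ eq → trans (cong₂ _+_ norm-1₂ eq) (-‿inverseʳ 1#))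

  norm-scaled : ∀ l y → norm y ≡ - 1# → norm (l *₂ 1₂) + norm (l *₂ y) ≡ 0#
  norm-scaled l y Ny≡-1 = begin
    norm (l *₂ 1₂) + norm (l *₂ y)   ≡⟨ cong₂ _+_ (norm-* l 1₂) (norm-* l y) ⟩
    norm l * norm 1₂ + norm l * norm y  ≡⟨ distribˡ _ _ _ ⟨
    norm l * (norm 1₂ + norm y)      ≡⟨ cong (norm l *_) (Equivalence.from (norm[1₂]+norm≡0⇔norm≡-1 y) Ny≡-1) ⟩
    norm l * 0#                      ≡⟨ zeroʳ _ ⟩
    0#                               ∎
    where open ≡-Reasoning

  -- If the first nonzero coordinate is x = 1, the equation says N(y) = -1 and z is free. If x = 0,
  -- then N(y) = 0, hence y = 0 and normalisation leaves one point. The `⊤` stands for the free z,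
  -- in the shape of `HasCard-×`.
  PtInfM⇔ : ∀ P → PtInfM P ⇔ (P ≡ pt∞ ⊎ ∃ λ yz → (norm (proj₁ yz) ≡ - 1# × ⊤) × P ≡ pt yz)
  PtInfM⇔ P = mk⇔ (to P) from
    where
    to : ∀ P → PtInfM P → P ≡ pt∞ ⊎ ∃ λ yz → (norm (proj₁ yz) ≡ - 1# × ⊤) × P ≡ pt yz
    to (J ∷ x ∷ y ∷ z ∷ []) (n , refl , inM) with Normalized-uncons (Normalized-tail (1₂≢0₂ ∘ sym) n)
                                                | Equivalence.to (InM-infinity⇔norm x y z) inM
    ... | inj₁ refl | N≡0 = inj₂ ((y , z) , (Equivalence.to (norm[1₂]+norm≡0⇔norm≡-1 y) N≡0 , tt) , refl)
    ... | inj₂ (refl , n₁) | N≡0 with norm[0₂]+norm≡0⇒≡0₂ y N≡0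
    ...   | refl with Normalized-uncons (Normalized-tail (1₂≢0₂ ∘ sym) n₁)
    ...     | inj₁ refl = inj₁ refl
    ...     | inj₂ (_ , ())
    from : (P ≡ pt∞ ⊎ ∃ λ yz → (norm (proj₁ yz) ≡ - 1# × ⊤) × P ≡ pt yz) → PtInfM P
    from (inj₁ refl) = there (there (there (here []))) , refl
      , Equivalence.from (InM-infinity⇔norm 0₂ 0₂ 1₂) (trans (cong₂ _+_ norm-0₂ norm-0₂) (+-identityˡ 0#))
    from (inj₂ ((y , z) , (N≡-1 , _) , refl)) = there (here (y ∷ z ∷ [])) , refl
      , Equivalence.from (InM-infinity⇔norm 1₂ y z) (Equivalence.from (norm[1₂]+norm≡0⇔norm≡-1 y) N≡-1)

  pt-injective : ∀ {u v} → pt u ≡ pt v → u ≡ v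
  pt-injective refl = refl

  pt∞≢pt : ∀ {u} → pt∞ ≢ pt u
  pt∞≢pt eq = 1₂≢0₂ (sym (cong (Vec.head ∘ Vec.tail) eq))

  card-F2 : HasCard F2 (λ _ → ⊤) (q N.* q)
  card-F2 = HasCard-resp-⇔ (λ _ → mk⇔ (λ _ → tt) (λ _ → tt , tt)) (HasCard-× card card)

  -- Shared by two counts: all points at infinity, with q + 1 values of y, and the lines inside the
  -- cone for q = 4m + 1, with two values.
  card-pt∞⊎pt : {P : F2 → Set} → ∀ {n} → HasCard F2 P n →
    HasCard (Vec F2 4) (λ v → v ≡ pt∞ ⊎ ∃ λ yz → (P (proj₁ yz) × ⊤) × v ≡ pt yz) (suc (n N.* (q N.* q)))
  card-pt∞⊎pt P-card = HasCard-insert pt∞ (λ { (_ , _ , eq) → pt∞≢pt eq })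
    (HasCard-image pt pt-injective (HasCard-× P-card card-F2))

  -- The norm equation is s² + d t² = c with d = -δ and c = -1.
  norm≡-1-solvable : ∃ λ u → norm u ≡ - 1#
  norm≡-1-solvable with s , t , eq ← s²+dt²≡c-solvable (- 1#) (- δ) (λ -δ≡0 → δ≢0 (-‿injective (trans -δ≡0 (sym -0#≈0#)))) =
    (s , t) , trans (solve 3 (λ s t d → s :* s :- d :* (t :* t) := s :* s :+ (:- d) :* (t :* t)) refl s t δ) eq

  -1≢0 : - 1# ≢ 0#
  -1≢0 -1≡0 = 0≢1 (sym (-‿injective (trans -1≡0 (sym -0#≈0#))))

  card-norm≡-1 : HasCard F2 (λ y → norm y ≡ - 1#) (suc q)
  card-norm≡-1 = from-solution norm≡-1-solvable
    where
    from-solution : (∃ λ u → norm u ≡ - 1#) → HasCard F2 (λ y → norm y ≡ - 1#) (suc q)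
    from-solution (u , Nu≡-1) = HasCard-resp-⇔
      (λ _ → mk⇔ (λ Ny≡Nu → trans Ny≡Nu Nu≡-1) (λ Ny≡-1 → trans Ny≡-1 (sym Nu≡-1)))
      (card-norm-fibre 1+1≢0 u (λ u≡0 → -1≢0 (trans (sym Nu≡-1) (trans (cong norm u≡0) norm-0₂))))

  card-PtInfM : HasCard (Vec F2 4) PtInfM (q N.^ 3 N.+ q N.^ 2 N.+ 1)
  card-PtInfM = subst (HasCard (Vec F2 4) PtInfM) (1+[1+q]q²≡q³+q²+1 q)
    (HasCard-resp-⇔ (λ P → mk⇔ (Equivalence.from (PtInfM⇔ P)) (Equivalence.to (PtInfM⇔ P))) (card-pt∞⊎pt card-norm≡-1))

  -- The partition into spread lines

  bcInf-injective : ∀ {x y z x′ y′ z′ : F2} → bcInf (0₂ ∷ x ∷ y ∷ z ∷ []) ≡ bcInf (0₂ ∷ x′ ∷ y′ ∷ z′ ∷ []) →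
                    x ≡ x′ × y ≡ y′ × z ≡ z′
  bcInf-injective = coordinates
    where
    coordinates : ∀ {w₀ w₁ w₂ w₃ w₄ w₅ w₆ v₀ v₁ v₂ v₃ v₄ v₅ v₆ : Carrier} →
      _≡_ {A = Vec Carrier 7} (w₀ ∷ w₁ ∷ w₂ ∷ w₃ ∷ w₄ ∷ w₅ ∷ w₆ ∷ []) (v₀ ∷ v₁ ∷ v₂ ∷ v₃ ∷ v₄ ∷ v₅ ∷ v₆ ∷ []) →
      (w₁ , w₂) ≡ (v₁ , v₂) × (w₃ , w₄) ≡ (v₃ , v₄) × (w₅ , w₆) ≡ (v₅ , v₆)
    coordinates refl = refl , refl , refl

  InS-bcInf : ∀ x y z → InS (bcInf (0₂ ∷ x ∷ y ∷ z ∷ [])) ⇔ (norm x + norm y ≡ 0#)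
  InS-bcInf (x₀ , x₁) (y₀ , y₁) z = mk⇔ (λ (_ , eq) → trans (sym norms) eq) (λ eq → refl , trans norms eq)
    where
    norms : sq x₀ - δ * sq x₁ + sq y₀ - δ * sq y₁ ≡ norm (x₀ , x₁) + norm (y₀ , y₁)
    norms = +-assoc _ _ _

  normalized⇒nonZero : ∀ {n} {v : Vec Carrier n} → NormalizedF v → v ≢ zeroV
  normalized⇒nonZero (here xs) eq = 0≢1 (sym (head eq))
    where
    head : ∀ {n x y} {xs ys : Vec Carrier n} → x ∷ xs ≡ y ∷ ys → x ≡ y
    head refl = refl
  normalized⇒nonZero (there v) eq = normalized⇒nonZero v (tail eq)
    where
    tail : ∀ {n x y} {xs ys : Vec Carrier n} → x ∷ xs ≡ y ∷ ys → xs ≡ ys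
    tail refl = refl

  _≟₂_ : (x y : F2) → Dec (x ≡ y)
  _≟₂_ = ≡-dec _≟_ _≟_

  *₂-zeroʳ : ∀ x → x *₂ 0₂ ≡ 0₂
  *₂-zeroʳ = F2ᵣ.zeroʳ

  *₂-identityʳ : ∀ x → x *₂ 1₂ ≡ x
  *₂-identityʳ = F2ᵣ.*-identityʳ

  bcInf-cong : ∀ {x y z x′ y′ z′} → x ≡ x′ → y ≡ y′ → z ≡ z′ →
               bcInf (0₂ ∷ x ∷ y ∷ z ∷ []) ≡ bcInf (0₂ ∷ x′ ∷ y′ ∷ z′ ∷ [])
  bcInf-cong refl refl refl = refl

  -- The coordinates of w are regrouped as (x, y, z) over F_{q²}. For x ≠ 0 the point is (1, y/x,
  -- z/x) with scalar x, and N(x) + N(y) = 0 becomes N(y/x) = -1. For x = 0 also y = 0, so the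
  -- scalar is z, nonzero because w is.
  spread-partition : ∀ w → NormalizedF w → InS w ⇔ (Σ (Vec F2 4) λ P → PtInfM P × OnSpreadLine P w)
  spread-partition w@(x₀ ∷ x₁ ∷ x₂ ∷ x₃ ∷ x₄ ∷ x₅ ∷ x₆ ∷ []) n = mk⇔ to from
    where
    x y z : F2
    x = x₁ , x₂
    y = x₃ , x₄
    z = x₅ , x₆
    to : InS w → Σ (Vec F2 4) λ P → PtInfM P × OnSpreadLine P w
    to inS@(refl , _) with Equivalence.to (InS-bcInf x y z) inS | x ≟₂ 0₂
    ... | N≡0 | no x≢0 = pt (y′ , x ⁻¹₂ *₂ z) , Equivalence.from (PtInfM⇔ _) (inj₂ (_ , (Ny′≡-1 , tt) , refl))
      , x , x≢0 , bcInf-cong (sym (*₂-identityʳ x)) (sym (x*[x⁻¹*y]≡y y x≢0)) (sym (x*[x⁻¹*y]≡y z x≢0))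
      where
      y′ = x ⁻¹₂ *₂ y
      open ≡-Reasoning
      Ny′≡-1 : norm y′ ≡ - 1#
      Ny′≡-1 = *-cancelˡ-nonZero (x≢0₂⇒norm≢0 x≢0) (begin
        norm x * norm y′             ≡⟨ norm-* x y′ ⟨
        norm (x *₂ y′)               ≡⟨ cong norm (x*[x⁻¹*y]≡y y x≢0) ⟩
        norm y                       ≡⟨ solve 2 (λ m n → n := m :+ n :+ m :* (:- con 1ℤ)) refl (norm x) (norm y) ⟩
        norm x + norm y + norm x * - 1#  ≡⟨ cong (_+ norm x * - 1#) N≡0 ⟩
        0# + norm x * - 1#           ≡⟨ +-identityˡ _ ⟩
        norm x * - 1#                ∎)
    ... | N≡0 | yes x≡0 = pt∞ , Equivalence.from (PtInfM⇔ _) (inj₁ refl)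
      , z , z≢0 , bcInf-cong (trans x≡0 (sym (*₂-zeroʳ z))) (trans y≡0 (sym (*₂-zeroʳ z))) (sym (*₂-identityʳ z))
      where
      y≡0 : y ≡ 0₂
      y≡0 = norm[0₂]+norm≡0⇒≡0₂ y (trans (cong (λ u → norm u + norm y) (sym x≡0)) N≡0)
      z≢0 : z ≢ 0₂
      z≢0 z≡0 = normalized⇒nonZero n (bcInf-cong x≡0 y≡0 z≡0)
    from : (Σ (Vec F2 4) λ P → PtInfM P × OnSpreadLine P w) → InS w
    from (P , P∈ , l , l≢0 , eq) with Equivalence.to (PtInfM⇔ P) P∈
    ... | inj₁ refl = subst InS (sym eq) (Equivalence.from (InS-bcInf (l *₂ 0₂) (l *₂ 0₂) (l *₂ 1₂)) (begin
      norm (l *₂ 0₂) + norm (l *₂ 0₂)   ≡⟨ cong (λ u → norm u + norm u) (*₂-zeroʳ l) ⟩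
      norm 0₂ + norm 0₂                 ≡⟨ cong₂ _+_ norm-0₂ norm-0₂ ⟩
      0# + 0#                           ≡⟨ +-identityˡ 0# ⟩
      0#                                ∎))
      where open ≡-Reasoning
    ... | inj₂ ((y , z) , (Ny≡-1 , _) , refl) = subst InS (sym eq)
      (Equivalence.from (InS-bcInf (l *₂ 1₂) (l *₂ y) (l *₂ z)) (norm-scaled l y Ny≡-1))

  -- The coordinate normalised to 1 reveals the scalar: two points with x = 1 share it and it
  -- cancels, while a point with x = 1 and one with x = 0 would need a zero scalar.
  spread-disjoint : ∀ P P′ w → PtInfM P → PtInfM P′ → OnSpreadLine P w → OnSpreadLine P′ w → P ≡ P′
  spread-disjoint P P′ w P∈ P′∈ (l , l≢0 , refl) (l′ , l′≢0 , eq)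
    with Equivalence.to (PtInfM⇔ P) P∈ | Equivalence.to (PtInfM⇔ P′) P′∈
  ... | inj₁ refl | inj₁ refl = refl
  ... | inj₁ refl | inj₂ (_ , _ , refl) =
    let e₁ , _ = bcInf-injective eq in
    ⊥-elim (l′≢0 (trans (sym (*₂-identityʳ l′)) (trans (sym e₁) (*₂-zeroʳ l))))
  ... | inj₂ (_ , _ , refl) | inj₁ refl =
    let e₁ , _ = bcInf-injective eq in
    ⊥-elim (l≢0 (trans (sym (*₂-identityʳ l)) (trans e₁ (*₂-zeroʳ l′))))
  ... | inj₂ (_ , _ , refl) | inj₂ (_ , _ , refl) with bcInf-injective eq
  ...   | e₁ , e₂ , e₃ with trans (sym (*₂-identityʳ l)) (trans e₁ (*₂-identityʳ l′))
  ...     | refl = cong pt (cong₂ _,_ (*₂-cancelˡ-nonZero l≢0 e₂) (*₂-cancelˡ-nonZero l≢0 e₃))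

  -- Spread lines contained in the cone

  QB-infinity : ∀ x y z → QB (bcInf (0₂ ∷ x ∷ y ∷ z ∷ [])) ≡
                proj₂ (a *₂ (x *₂ x +₂ y *₂ y)) - b₁ * (norm x + norm y)
  QB-infinity (x₀ , x₁) (y₀ , y₁) (_ , z₁) = solve 9 (λ x₀ x₁ y₀ y₁ z a₀ a₁ b₁ d →
      let N = λ u v → u :* u :- d :* (v :* v)
          c = con 1ℤ :+ con 1ℤ
          sq = λ x → x :* x in
      con 0ℤ :* z :+ c :* a₀ :* (x₀ :* x₁ :+ y₀ :* y₁)
        :+ a₁ :* (sq x₀ :+ sq y₀ :+ d :* (sq x₁ :+ sq y₁))
        :- b₁ :* (sq x₀ :- d :* sq x₁ :+ sq y₀ :- d :* sq y₁)
      := a₀ :* (x₀ :* x₁ :+ x₁ :* x₀ :+ (y₀ :* y₁ :+ y₁ :* y₀))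
            :+ a₁ :* (x₀ :* x₀ :+ d :* (x₁ :* x₁) :+ (y₀ :* y₀ :+ d :* (y₁ :* y₁)))
        :- b₁ :* (N x₀ x₁ :+ N y₀ y₁)) refl
      x₀ x₁ y₀ y₁ z₁ a₀ a₁ b₁ δ

  -- The b₁-term carries the factor N(l)(1 + N(y)) = 0, so only the a-term remains.
  QB-line : ∀ l y z → norm y ≡ - 1# →
            QB (bcInf (Vec.map (l *₂_) (pt (y , z)))) ≡ proj₂ (a *₂ (1₂ +₂ y *₂ y) *₂ (l *₂ l))
  QB-line l y z Ny≡-1 = begin
    QB (bcInf (Vec.map (l *₂_) (pt (y , z))))
      ≡⟨ QB-infinity (l *₂ 1₂) (l *₂ y) (l *₂ z) ⟩
    proj₂ (a *₂ ((l *₂ 1₂) *₂ (l *₂ 1₂) +₂ (l *₂ y) *₂ (l *₂ y))) - b₁ * (norm (l *₂ 1₂) + norm (l *₂ y))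
      ≡⟨ cong₂ (λ u v → proj₂ u - b₁ * v)
           (solve₂ 3 (λ a l y → a :*₂ ((l :*₂ con₂ 1ℤ) :*₂ (l :*₂ con₂ 1ℤ) :+₂ (l :*₂ y) :*₂ (l :*₂ y))
             :=₂ a :*₂ (con₂ 1ℤ :+₂ y :*₂ y) :*₂ (l :*₂ l)) refl a l y)
           (norm-scaled l y Ny≡-1) ⟩
    proj₂ (a *₂ (1₂ +₂ y *₂ y) *₂ (l *₂ l)) - b₁ * 0#
      ≡⟨ solve 2 (λ u b → u :- b :* con 0ℤ := u) refl _ b₁ ⟩
    proj₂ (a *₂ (1₂ +₂ y *₂ y) *₂ (l *₂ l)) ∎
    where open ≡-Reasoning

  -- The squares 1 and (1 + ε)² already span F_{q²} over F_q.
  imaginary-squares⇒0₂ : ∀ c → (∀ l → l ≢ 0₂ → proj₂ (c *₂ (l *₂ l)) ≡ 0#) → c ≡ 0₂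
  imaginary-squares⇒0₂ c@(c₀ , c₁) h = cong₂ _,_ c₀≡0 c₁≡0
    where
    open ≡-Reasoning
    c₁≡0 : c₁ ≡ 0#
    c₁≡0 = trans (cong proj₂ (sym (trans (cong (c *₂_) (*₂-identityʳ 1₂)) (*₂-identityʳ c)))) (h 1₂ 1₂≢0₂)
    c₀≡0 : c₀ ≡ 0#
    c₀≡0 = x≢0∧x*y≡0⇒y≡0 1+1≢0 (begin
      two * c₀
        ≡⟨ solve 3 (λ c₀ c₁ d → let i = con 1ℤ in
             (i :+ i) :* c₀ := c₀ :* (i :* i :+ i :* i) :+ c₁ :* (i :* i :+ d :* (i :* i)) :- c₁ :* (i :+ d)) refl c₀ c₁ δ ⟩
      proj₂ (c *₂ ((1# , 1#) *₂ (1# , 1#))) - c₁ * (1# + δ)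
        ≡⟨ cong₂ (λ u v → u - v * (1# + δ)) (h (1# , 1#) (λ eq → 0≢1 (sym (cong proj₁ eq)))) c₁≡0 ⟩
      0# - 0# * (1# + δ)
        ≡⟨ solve 1 (λ u → con 0ℤ :- con 0ℤ :* u := con 0ℤ) refl (1# + δ) ⟩
      0# ∎)

  -- Both y₀² - δ y₁² and y₀² + δ y₁² equal -1, so 2δ y₁² = 0. Conversely, norm and square agree on
  -- F_q.
  norm≡-1∧y²≡-1⇔ : ∀ y → (norm y ≡ - 1# × 1₂ +₂ y *₂ y ≡ 0₂) ⇔ (∃ λ i → i * i ≡ - 1# × y ≡ (i , 0#))
  norm≡-1∧y²≡-1⇔ y@(y₀ , y₁) = mk⇔ to from
    where
    open ≡-Reasoning
    to : norm y ≡ - 1# × 1₂ +₂ y *₂ y ≡ 0₂ → ∃ λ i → i * i ≡ - 1# × y ≡ (i , 0#)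
    to (Ny≡-1 , 1+y²≡0) = y₀ , y₀²≡-1 , cong (y₀ ,_) y₁≡0
      where
      y₁≡0 : y₁ ≡ 0#
      y₁≡0 = x*x≡0⇒x≡0 (x≢0∧x*y≡0⇒y≡0 (x≢0∧y≢0⇒x*y≢0 1+1≢0 δ≢0) (begin
        two * δ * (y₁ * y₁)
          ≡⟨ solve 3 (λ y₀ y₁ d → let i = con 1ℤ in (i :+ i) :* d :* (y₁ :* y₁)
               := i :+ (y₀ :* y₀ :+ d :* (y₁ :* y₁)) :- (i :+ (y₀ :* y₀ :- d :* (y₁ :* y₁)))) refl y₀ y₁ δ ⟩
        proj₁ (1₂ +₂ y *₂ y) - (1# + norm y)
          ≡⟨ cong₂ (λ u v → proj₁ u - (1# + v)) 1+y²≡0 Ny≡-1 ⟩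
        0# - (1# + - 1#)
          ≡⟨ solve 0 (con 0ℤ :- (con 1ℤ :- con 1ℤ) := con 0ℤ) refl ⟩
        0# ∎))
      y₀²≡-1 : y₀ * y₀ ≡ - 1#
      y₀²≡-1 = begin
        y₀ * y₀                   ≡⟨ solve 2 (λ y₀ d → y₀ :* y₀ := y₀ :* y₀ :- d :* (con 0ℤ :* con 0ℤ)) refl y₀ δ ⟩
        norm (y₀ , 0#)            ≡⟨ cong (λ u → norm (y₀ , u)) y₁≡0 ⟨
        norm y                    ≡⟨ Ny≡-1 ⟩
        - 1#                      ∎
    from : (∃ λ i → i * i ≡ - 1# × y ≡ (i , 0#)) → norm y ≡ - 1# × 1₂ +₂ y *₂ y ≡ 0₂
    from (i , i²≡-1 , refl) =
      trans (solve 2 (λ i d → i :* i :- d :* (con 0ℤ :* con 0ℤ) := i :* i) refl i δ) i²≡-1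
      , cong₂ _,_
        (trans (solve 2 (λ i d → con 1ℤ :+ (i :* i :+ d :* (con 0ℤ :* con 0ℤ)) := con 1ℤ :+ i :* i) refl i δ)
               (trans (cong (1# +_) i²≡-1) (-‿inverseʳ 1#)))
        (solve 1 (λ i → con 0ℤ :+ (i :* con 0ℤ :+ con 0ℤ :* i) := con 0ℤ) refl i)

  q≡4m+r : ∀ {r} → q % 4 ≡ r → q ≡ r N.+ (q / 4) N.* 4
  q≡4m+r q%4≡r = trans (m≡m%n+[m/n]*n q 4) (cong (N._+ (q / 4) N.* 4) q%4≡r)

  -- For q = 4m + 1, comparing ε^q = ε δ^{2m} with - ε gives (δ^m)² = -1.
  q%4≡1⇒√-1 : q % 4 ≡ 1 → ∃ λ i → i * i ≡ - 1#
  q%4≡1⇒√-1 q%4≡1 = δ ^ m , cong proj₂ (begin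
    (0# , δ ^ m * δ ^ m)          ≡⟨ ε*δ² ⟨
    ε *₂ (δ ^ m * δ ^ m , 0#)     ≡⟨ cong (ε *₂_) (ε^4m m) ⟨
    ε *₂ ε ^₂ (m N.* 4)           ≡⟨ cong (ε ^₂_) (q≡4m+r q%4≡1) ⟨
    ε ^₂ q                        ≡⟨ ε^q≡-ε ⟩
    neg₂ ε                        ∎)
    where
    open ≡-Reasoning
    m = q / 4
    ε*δ² : ε *₂ (δ ^ m * δ ^ m , 0#) ≡ (0# , δ ^ m * δ ^ m)
    ε*δ² = cong₂ _,_
      (solve 2 (λ u d → con 0ℤ :* u :+ d :* (con 1ℤ :* con 0ℤ) := con 0ℤ) refl _ δ)
      (solve 1 (λ u → con 0ℤ :* con 0ℤ :+ con 1ℤ :* u := u) refl _)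
    ε^4m : ∀ m → ε ^₂ (m N.* 4) ≡ (δ ^ m * δ ^ m , 0#)
    ε^4m zero    = cong (_, 0#) (sym (*-identityˡ 1#))
    ε^4m (suc m) = begin
      ε *₂ (ε *₂ (ε *₂ (ε *₂ ε ^₂ (m N.* 4))))
        ≡⟨ solve₂ 2 (λ e u → e :*₂ (e :*₂ (e :*₂ (e :*₂ u))) :=₂ (e :*₂ e) :*₂ (e :*₂ e) :*₂ u) refl ε _ ⟩
      (ε *₂ ε) *₂ (ε *₂ ε) *₂ ε ^₂ (m N.* 4)
        ≡⟨ cong₂ (λ u v → u *₂ u *₂ v) ε² (ε^4m m) ⟩
      (δ , 0#) *₂ (δ , 0#) *₂ (δ ^ m * δ ^ m , 0#)
        ≡⟨ cong₂ _,_
          (solve 2 (λ d u → let o = con 0ℤ in (d :* d :+ d :* (o :* o)) :* (u :* u) :+ d :* ((d :* o :+ o :* d) :* o)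
             := d :* u :* (d :* u)) refl δ (δ ^ m))
          (solve 2 (λ d u → let o = con 0ℤ in (d :* d :+ d :* (o :* o)) :* o :+ (d :* o :+ o :* d) :* (u :* u)
             := o) refl δ (δ ^ m)) ⟩
      (δ ^ suc m * δ ^ suc m , 0#) ∎

  -- A root i of -1 has i⁴ = 1, so i^q = i³ = -i; but i^q = i, whence 2i = 0.
  q%4≡3⇒¬√-1 : q % 4 ≡ 3 → ∀ i → i * i ≢ - 1#
  q%4≡3⇒¬√-1 q%4≡3 i i²≡-1 = i≢0 (x≢0∧x*y≡0⇒y≡0 1+1≢0 (begin
    two * i            ≡⟨ solve 1 (λ i → (con 1ℤ :+ con 1ℤ) :* i := i :- (:- i)) refl i ⟩
    i - (- i)          ≡⟨ cong (λ u → u - (- i)) (trans (sym (x^q≡x i)) (cong (i ^_) (q≡4m+r q%4≡3))) ⟩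
    i * (i * (i * i ^ ((q / 4) N.* 4))) - (- i)  ≡⟨ cong (λ u → i * (i * (i * u)) - (- i)) (i^4m (q / 4)) ⟩
    i * (i * (i * 1#)) - (- i)  ≡⟨ solve 1 (λ i → i :* (i :* (i :* con 1ℤ)) :- (:- i) := i :* (i :* i) :- (:- i)) refl i ⟩
    i * (i * i) - (- i)  ≡⟨ cong (λ u → i * u - (- i)) i²≡-1 ⟩
    i * - 1# - (- i)   ≡⟨ solve 1 (λ i → i :* (:- con 1ℤ) :- (:- i) := con 0ℤ) refl i ⟩
    0#                 ∎))
    where
    open ≡-Reasoning
    i≢0 : i ≢ 0#
    i≢0 i≡0 = -1≢0 (trans (sym i²≡-1) (trans (cong (_* i) i≡0) (zeroˡ i)))
    i^4m : ∀ m → i ^ (m N.* 4) ≡ 1#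
    i^4m zero    = refl
    i^4m (suc m) = begin
      i * (i * (i * (i * i ^ (m N.* 4))))   ≡⟨ cong (λ u → i * (i * (i * (i * u)))) (i^4m m) ⟩
      i * (i * (i * (i * 1#)))              ≡⟨ solve 1 (λ i → i :* (i :* (i :* (i :* con 1ℤ))) := i :* i :* (i :* i)) refl i ⟩
      i * i * (i * i)                       ≡⟨ cong₂ _*_ i²≡-1 i²≡-1 ⟩
      - 1# * - 1#                           ≡⟨ solve 0 ((:- con 1ℤ) :* (:- con 1ℤ) := con 1ℤ) refl ⟩
      1#                                    ∎

  card-√-1 : (∃ λ i → i * i ≡ - 1#) → HasCard F2 (λ y → ∃ λ i → i * i ≡ - 1# × y ≡ (i , 0#)) 2
  card-√-1 (i , i²≡-1) = HasCard-resp-⇔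
    (λ y → mk⇔
      (λ { (inj₁ refl) → - i , trans (solve 1 (λ i → (:- i) :* (:- i) := i :* i) refl i) i²≡-1 , refl
         ; (inj₂ refl) → i , i²≡-1 , refl })
      (λ { (j , j²≡-1 , refl) → roots j (x*x≡y*y⇒x≡y∨x≡-y j i (trans j²≡-1 (sym i²≡-1))) }))
    (HasCard-insert (- i , 0#) -i≢i (HasCard-singleton (i , 0#)))
    where
    roots : ∀ j → j ≡ i ⊎ j ≡ - i → (j , 0#) ≡ (- i , 0#) ⊎ (j , 0#) ≡ (i , 0#)
    roots j (inj₁ refl) = inj₂ refl
    roots j (inj₂ refl) = inj₁ refl
    -i≢i : (- i , 0#) ≢ (i , 0#)
    -i≢i eq = -1≢0 (trans (sym i²≡-1) (trans (cong (_* i) i≡0) (zeroˡ i)))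
      where
      i≡0 : i ≡ 0#
      i≡0 = x≢0∧x*y≡0⇒y≡0 1+1≢0 (trans
        (solve 1 (λ i → (con 1ℤ :+ con 1ℤ) :* i := i :- (:- i)) refl i)
        (trans (cong (λ u → i - u) (cong proj₁ eq)) (-‿inverseʳ i)))

  module _ (a≢0 : a ≢ 0₂) where

    -- Vanishing of the ε-component for every nonzero l forces a(1 + y²) = 0, from which a cancels.
    LineInB-pt⇔ : ∀ y z → norm y ≡ - 1# → LineInB (pt (y , z)) ⇔ (1₂ +₂ y *₂ y ≡ 0₂)
    LineInB-pt⇔ y z Ny≡-1 = mk⇔
      (λ inB → x≢0₂∧x*y≡0₂⇒y≡0₂ a≢0 (imaginary-squares⇒0₂ _
        (λ l l≢0 → trans (sym (QB-line l y z Ny≡-1)) (inB _ (l , l≢0 , refl)))))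
      (λ { 1+y²≡0 _ (l , _ , refl) → trans (QB-line l y z Ny≡-1) (begin
        proj₂ (a *₂ (1₂ +₂ y *₂ y) *₂ (l *₂ l))  ≡⟨ cong (λ u → proj₂ (a *₂ u *₂ (l *₂ l))) 1+y²≡0 ⟩
        proj₂ (a *₂ 0₂ *₂ (l *₂ l))              ≡⟨ cong proj₂ (solve₂ 2 (λ a m → a :*₂ con₂ 0ℤ :*₂ m :=₂ con₂ 0ℤ) refl a (l *₂ l)) ⟩
        0#                                       ∎) })
      where open ≡-Reasoning

    LineInB-pt∞ : LineInB pt∞
    LineInB-pt∞ _ (l , _ , refl) = begin
      QB (bcInf (Vec.map (l *₂_) pt∞))                     ≡⟨ QB-infinity (l *₂ 0₂) (l *₂ 0₂) (l *₂ 1₂) ⟩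
      proj₂ (a *₂ ((l *₂ 0₂) *₂ (l *₂ 0₂) +₂ (l *₂ 0₂) *₂ (l *₂ 0₂))) - b₁ * (norm (l *₂ 0₂) + norm (l *₂ 0₂))
        ≡⟨ cong₂ (λ u v → proj₂ u - b₁ * (v + v))
             (solve₂ 2 (λ a l → let o = l :*₂ con₂ 0ℤ in a :*₂ (o :*₂ o :+₂ o :*₂ o) :=₂ con₂ 0ℤ) refl a l)
             (trans (cong norm (*₂-zeroʳ l)) norm-0₂) ⟩
      0# - b₁ * (0# + 0#)
        ≡⟨ solve 1 (λ b → con 0ℤ :- b :* (con 0ℤ :+ con 0ℤ) := con 0ℤ) refl b₁ ⟩
      0# ∎
      where open ≡-Reasoning

    PtInfM∧LineInB⇔ : ∀ P → (PtInfM P × LineInB P) ⇔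
      (P ≡ pt∞ ⊎ ∃ λ yz → ((∃ λ i → i * i ≡ - 1# × proj₁ yz ≡ (i , 0#)) × ⊤) × P ≡ pt yz)
    PtInfM∧LineInB⇔ P = mk⇔ (λ (P∈ , inB) → to (Equivalence.to (PtInfM⇔ P) P∈) inB) from
      where
      to : (P ≡ pt∞ ⊎ ∃ λ yz → (norm (proj₁ yz) ≡ - 1# × ⊤) × P ≡ pt yz) → LineInB P →
           P ≡ pt∞ ⊎ ∃ λ yz → ((∃ λ i → i * i ≡ - 1# × proj₁ yz ≡ (i , 0#)) × ⊤) × P ≡ pt yz
      to (inj₁ P≡pt∞) _ = inj₁ P≡pt∞
      to (inj₂ ((y , z) , (Ny≡-1 , _) , refl)) inB = inj₂ ((y , z)
        , (Equivalence.to (norm≡-1∧y²≡-1⇔ y) (Ny≡-1 , Equivalence.to (LineInB-pt⇔ y z Ny≡-1) inB) , tt) , refl)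
      from : (P ≡ pt∞ ⊎ ∃ λ yz → ((∃ λ i → i * i ≡ - 1# × proj₁ yz ≡ (i , 0#)) × ⊤) × P ≡ pt yz) →
             PtInfM P × LineInB P
      from (inj₁ refl) = Equivalence.from (PtInfM⇔ pt∞) (inj₁ refl) , LineInB-pt∞
      from (inj₂ ((y , z) , (i , _) , refl)) =
        let Ny≡-1 , 1+y²≡0 = Equivalence.from (norm≡-1∧y²≡-1⇔ y) i in
        Equivalence.from (PtInfM⇔ _) (inj₂ (_ , (Ny≡-1 , tt) , refl))
        , Equivalence.from (LineInB-pt⇔ y z Ny≡-1) 1+y²≡0

    card-LineInB-1 : q % 4 ≡ 1 → HasCard (Vec F2 4) (λ P → PtInfM P × LineInB P) (2 N.* q N.^ 2 N.+ 1)
    card-LineInB-1 q%4≡1 = subst (HasCard (Vec F2 4) _) (1+2q²≡2q²+1 q)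
      (HasCard-resp-⇔ (λ P → mk⇔ (Equivalence.from (PtInfM∧LineInB⇔ P)) (Equivalence.to (PtInfM∧LineInB⇔ P)))
        (card-pt∞⊎pt (card-√-1 (q%4≡1⇒√-1 q%4≡1))))

    card-LineInB-3 : q % 4 ≡ 3 → HasCard (Vec F2 4) (λ P → PtInfM P × LineInB P) 1
    card-LineInB-3 q%4≡3 =
      HasCard-resp-⇔ (λ P → mk⇔
        (λ P≡pt∞ → Equivalence.from (PtInfM∧LineInB⇔ P) (inj₁ P≡pt∞))
        (λ P∈ → only P (Equivalence.to (PtInfM∧LineInB⇔ P) P∈)))
        (HasCard-singleton pt∞)
      where
      only : ∀ P → (P ≡ pt∞ ⊎ ∃ λ yz → ((∃ λ i → i * i ≡ - 1# × proj₁ yz ≡ (i , 0#)) × ⊤) × P ≡ pt yz) → P ≡ pt∞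
      only P (inj₁ P≡pt∞) = P≡pt∞
      only P (inj₂ (_ , ((i , i²≡-1 , _) , _) , _)) = ⊥-elim (q%4≡3⇒¬√-1 q%4≡3 i i²≡-1)

open import Data.Nat using (_^_)

theorem5p4 : (q : ℕ) → (Σ ℕ λ p → Σ ℕ λ k → Prime p × q ≡ p ^ suc k) → q % 2 ≡ 1 →
    (K : FiniteField q) → (δ : FiniteField.Carrier K) →
    let open Setting K δ in
    (∀ t → t * t ≢ δ) →
    ε ^₂ q ≡ neg₂ ε →
    (a b : F2) → a ≢ 0₂ → ¬ InFq b →
    four₂ *₂ a ^₂ suc q +₂ (b ^₂ q -₂ b) ^₂ 2 ≢ 0₂ →
    let open BM a b in
    (∀ x y z → InM (1₂ ∷ x ∷ y ∷ z ∷ []) ⇔ (QB (bcAff x y z) ≡ 0#)) ×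
    (∀ v → NormalizedF v → ((QB v ≡ 0# × (∀ w → polar QB v w ≡ 0#)) ⇔ v ≡ V)) ×
    HyperbolicPG5 QBase ×
    HasCard (Vec F2 4) PtInfM (q ^ 3 N.+ q ^ 2 N.+ 1) ×
    (∀ w → NormalizedF w → InS w ⇔ (Σ (Vec F2 4) λ P → PtInfM P × OnSpreadLine P w)) ×
    (∀ P P′ w → PtInfM P → PtInfM P′ → OnSpreadLine P w → OnSpreadLine P′ w → P ≡ P′) ×
    (q % 4 ≡ 1 → HasCard (Vec F2 4) (λ P → PtInfM P × LineInB P) (2 N.* q ^ 2 N.+ 1)) ×
    (q % 4 ≡ 3 → HasCard (Vec F2 4) (λ P → PtInfM P × LineInB P) 1)
theorem5p4 q (p , k , p-prime , q≡p^[1+k]) q-odd K δ δ-nonsquare ε^q≡-ε a b a≢0 _ nondegenerate =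
  InM-affine⇔QB , singular⇔V disc≢0 , QBase-hyperbolic disc≢0 , card-PtInfM ,
  spread-partition , spread-disjoint , card-LineInB-1 a≢0 , card-LineInB-3 a≢0
  where
  open Cone K δ a b q-odd
  open Infinity K δ δ-nonsquare q-odd {k = suc k} p-prime q≡p^[1+k] ε^q≡-ε a b
  disc≢0 = discriminant≢0 nondegenerate
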